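{- For each $G \in \widetilde{\mathbb{G}}$, the following hold: 1. $\lambda_t(G)$, $\rho_t(G)$, $G_t$ (for all $t\in\mathbb{Z}[\frac12]$) and $t(G)$ are well-defined by the recursion given in the context (that is, whenever the game under consideration is not equal to an integer, the maximum, the minimum, and the least element $\min\{t\in\mathbb{Z}[\frac12] \mid \widetilde{\lambda}_t=\widetilde{\rho}_t\}$ occurring in the recursion exist), and $t(G)>-1$ if $G$ is not equal to an integer. 2. $t\mapsto\lambda_t(G)$ is a diadic trajectory consisting of segments with slope $0$ or $-1$. 3. $t\mapsto\rho_t(G)$ is a diadic trajectory consisting of segments with slope $0$ or $1$. 4. Both $\lambda_t(G)$ and $\rho_t(G)$ (as functions of $t$) have masts, and their mast values are equal. 5. For all $t \in \mathbb{Z}[\frac12]$, $L(G_t)=\lambda_t(G)$ and $R(G_t)=\rho_t(G)$. 6. Suppose $G$ is not equal to an integer. Then, for each $t\in\mathbb{Z}[\frac12]$ with $t>-1$: (a) if $t<t(G)$, then $G_t$ is not numberish; (b) if $t=t(G)$, then $G_t$ is numberish; (c) if $t>t(G)$, then $G_t$ is equal to a number.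
   Context: Games. $\widetilde{\mathbb{G}}$ is the set of all formal (short, i.e. finite loopfree) normal-play partizan games $G=\{G^L\mid G^R\}$, where $G^L$ (resp. $G^R$) ranges over the finitely many Left (resp. Right) options of $G$; $\tilde b(G)$ is the formal birthday (height of the game tree). Sums and negatives of games are the usual ones; $G\ge 0$ means Left wins $G$ moving second under normal play, $G\ge H$ means $G-H\ge 0$, and $G$ is equal to $H$ (equality of game values) if $G\ge H$ and $H\ge G$. $\mathbb{G}$ is the group of game values. The dyadic rationals $\mathbb{Z}[\frac12]$ are identified in the usual way with the subgroup of numbers in $\mathbb{G}$; "equal to an integer/number" means having such a game value. When a dyadic rational is used as a formal game, its canonical form is meant. Stops. $L(G)=R(G)=x$ if $G$ is equal to a number $x$; otherwise $L(G)=\max_{G^L}R(G^L)$ and $R(G)=\min_{G^R}L(G^R)$. $G$ is numberish if it is infinitesimally close to some number $x$, i.e. $-\varepsilon<G-x<\varepsilon$ for every positive number $\varepsilon$. Cooling and temperature. For $G\in\widetilde{\mathbb{G}}$ and $t\in\mathbb{Z}[\frac12]$, define $\lambda_t(G),\rho_t(G)\in\mathbb{Z}[\frac12]$, $G_t\in\widetilde{\mathbb{G}}$ and $t(G)\in\mathbb{Z}[\frac12]\cup\{ -\infty\}$ by recursion on $\tilde b(G)$: - If $G$ is equal to an integer $n$: $\lambda_t(G)=\rho_t(G)=n$, $G_t=n$ (canonical form), $t(G)=-\infty$. - Otherwise let $\widetilde{\lambda}_t(G)=\max_{G^L}\{\rho_t(G^L)-t\}$, $\widetilde{\rho}_t(G)=\min_{G^R}\{\lambda_t(G^R)+t\}$,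 $\widetilde{G}_t=\{(G^L)_t-t\mid (G^R)_t+t\}$ (with all $G^L$, $G^R$), and $t(G)=\min\{t\in\mathbb{Z}[\frac12]\mid \widetilde{\lambda}_t(G)=\widetilde{\rho}_t(G)\}$. If $t\le t(G)$, set $\lambda_t(G)=\widetilde{\lambda}_t(G)$, $\rho_t(G)=\widetilde{\rho}_t(G)$, $G_t=\widetilde{G}_t$. If $t>t(G)$, set $\lambda_t(G)=\rho_t(G)=x$ and $G_t=x$ (canonical form), where $x=\lambda_{t(G)}(G)=\rho_{t(G)}(G)$. Diadic trajectories. A diadic trajectory is a function $f:\mathbb{Z}[\frac12]\to\mathbb{Z}[\frac12]$ of the form $f(x)=a_0x+b_0$ for $x\le j_0$, $f(x)=a_ix+b_i$ for $j_{i-1}\le x\le j_i$ ($i=1,\dots,n$), $f(x)=a_{n+1}x+b_{n+1}$ for $x\ge j_n$, where $n\ge 0$, $j_0,\dots,j_n\in\mathbb{Z}[\frac12]$, all $b_i\in\mathbb{Z}[\frac12]$, all $a_i\in\{ -1,0,1\}$, and $a_ij_i+b_i=a_{i+1}j_i+b_{i+1}$ for $0\le i\le n$ (the pieces, including the two half lines, join up). It consists of segments with slopes in a set $A$ if it can be written so with all $a_i\in A$. If $a_{n+1}=0$, the last half line is called its mast, and $b_{n+1}$ its mast value. -}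

module Defs where

import Algebra.Construct.NaturalChoice.Max
import Algebra.Construct.NaturalChoice.Min
open import Data.Bool.Base using (if_then_else_)
open import Data.Fin.Base using (Fin; zero; suc; inject₁; fromℕ)
open import Data.Integer.Base as ℤ using (ℤ; +_; -[1+_]; 0ℤ; 1ℤ; -1ℤ)
open import Data.Integer.DivMod using (_/ℕ_; _%ℕ_)
import Data.Integer.Properties as ℤ
open import Data.Irrelevant as Irrelevant using ([_])
open import Data.List.Base as List using (List)
open import Data.List.Membership.Propositional using (_∈_)
open import Data.Nat.Base as ℕ using (ℕ; zero; suc; _^_)
open import Data.Nat.Coprimality using (Coprime; coprime-divisor)
open import Data.Nat.Divisibility using (_∣_; _∣?_; divides; ∣1⇒≡1; *-cancelˡ-∣)
open import Data.Nat.Logarithm using (⌊log₂_⌋)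
open import Data.Nat.Primality using (irreducible[2])
import Data.Nat.Properties as ℕ
open import Data.Product.Base using (Σ-syntax; ∃-syntax; _×_; _,_)
open import Data.Rational.Base as ℚ using (ℚ; ↥_; ↧_; ↧ₙ_)
open import Data.Rational.Literals using (fromℤ)
import Data.Rational.Properties as ℚ
open import Data.Refinement.Base using (Refinement-syntax; value; _,_)
open import Data.Sum.Base using (inj₁; inj₂)
open import Data.Vec.Functional using (Vector; []; _∷_; _++_)
open import Function.Base using (_∘_; _on_)
open import Level using (0ℓ)
open import Relation.Binary.Bundles using (DecTotalOrder)
open import Relation.Binary.Core using (Rel)
import Relation.Binary.Construct.On as On
open import Relation.Binary.PropositionalEquality using (_≡_; refl; sym; trans; cong; cong₂; subst)
open import Relation.Nullary using (¬_; does; yes; no)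
open import Relation.Nullary.Construct.Add.Infimum using (_₋; ⊥₋; [_])
open import Relation.Nullary.Negation using (contradiction)
open import Relation.Unary using (Pred)

infix  8 -_ ⊖_
infixl 7 _*_
infixl 6 _+_ _-_ _⊕_ _⊝_
infix  4 _<_ _≽_ _≈_ _≺_

-- Elements of ℚ are in lowest terms.
IsDyadic : Pred ℚ 0ℓ
IsDyadic q = ∃[ k ] ↧ₙ q ≡ 2 ^ k

ℤ[½] : Set
ℤ[½] = [ q ∈ ℚ ∣ IsDyadic q ]

∣2^k⇒≡2^j : ∀ {d} k → d ∣ 2 ^ k → ∃[ j ] d ≡ 2 ^ j
∣2^k⇒≡2^j zero d∣1 = 0 , ∣1⇒≡1 d∣1
∣2^k⇒≡2^j {d} (suc k) d∣2^k with 2 ∣? d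
... | yes (divides c refl) =
  let j , c≡2^j = ∣2^k⇒≡2^j {c} k (*-cancelˡ-∣ 2 (subst (_∣ 2 ^ suc k) (ℕ.*-comm c 2) d∣2^k))
  in suc j , trans (ℕ.*-comm c 2) (cong (2 ℕ.*_) c≡2^j)
... | no 2∤d = ∣2^k⇒≡2^j k (coprime-divisor coprime d∣2^k)
  where
  coprime : Coprime d 2
  coprime (i∣d , i∣2) with irreducible[2] i∣2
  ... | inj₁ i≡1  = i≡1
  ... | inj₂ refl = contradiction i∣d 2∤d

isDyadic-divides : ∀ {r g} p q → ↧ r ℤ.* g ≡ ↧ p ℤ.* ↧ q →
                   IsDyadic p → IsDyadic q → IsDyadic r
isDyadic-divides {r} {g} p q eq (k , ↧p≡2^k) (l , ↧q≡2^l) =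
  ∣2^k⇒≡2^j (k ℕ.+ l) (divides ℤ.∣ g ∣ 2^[k+l]≡)
  where
  2^[k+l]≡ : 2 ^ (k ℕ.+ l) ≡ ℤ.∣ g ∣ ℕ.* ↧ₙ r
  2^[k+l]≡ = trans (ℕ.^-distribˡ-+-* 2 k l)
    (trans (sym (cong₂ ℕ._*_ ↧p≡2^k ↧q≡2^l))
    (trans (sym (cong ℤ.∣_∣ eq))
    (trans (ℤ.abs-* (↧ r) g) (ℕ.*-comm (↧ₙ r) ℤ.∣ g ∣))))

isDyadic-+ : ∀ p q → IsDyadic p → IsDyadic q → IsDyadic (p ℚ.+ q)
isDyadic-+ p q = isDyadic-divides {p ℚ.+ q} p q (ℚ.↧-+ p q)

isDyadic-* : ∀ p q → IsDyadic p → IsDyadic q → IsDyadic (p ℚ.* q)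
isDyadic-* p q = isDyadic-divides {p ℚ.* q} p q (ℚ.↧-* p q)

isDyadic-neg : ∀ p → IsDyadic p → IsDyadic (ℚ.- p)
isDyadic-neg p (k , eq) = k , trans (cong ℤ.∣_∣ (ℚ.↧-neg p)) eq

integer : ℤ → ℤ[½]
integer n = fromℤ n , [ (0 , refl) ]

_+_ _*_ : ℤ[½] → ℤ[½] → ℤ[½]
(p , dp) + (q , dq) = p ℚ.+ q , Irrelevant.zipWith (isDyadic-+ p q) dp dq
(p , dp) * (q , dq) = p ℚ.* q , Irrelevant.zipWith (isDyadic-* p q) dp dq

-_ : ℤ[½] → ℤ[½]
- (p , dp) = ℚ.- p , Irrelevant.map (isDyadic-neg p) dp

_-_ : ℤ[½] → ℤ[½] → ℤ[½]
x - y = x + - y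

≤-decTotalOrder : DecTotalOrder _ _ _
≤-decTotalOrder = On.decTotalOrder ℚ.≤-decTotalOrder (value {P = IsDyadic})

open DecTotalOrder ≤-decTotalOrder public using (_≤_; _≤?_)

open Algebra.Construct.NaturalChoice.Max (DecTotalOrder.totalOrder ≤-decTotalOrder) public using (_⊔_)

open Algebra.Construct.NaturalChoice.Min (DecTotalOrder.totalOrder ≤-decTotalOrder) public using (_⊓_)

_<_ : Rel ℤ[½] _
_<_ = ℚ._<_ on value

max min : ∀ {n} → Vector ℤ[½] (suc n) → ℤ[½]
max {zero}  x = x zero
max {suc n} x = x zero ⊔ max (x ∘ suc)
min {zero}  x = x zero
min {suc n} x = x zero ⊓ min (x ∘ suc)

IsLeast : Pred ℤ[½] 0ℓ → Pred ℤ[½] 0ℓ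
IsLeast P x = P x × (∀ y → P y → x ≤ y)

data Game : Set where
  ⟨_∣_⟩ : ∀ {m n} → Vector Game m → Vector Game n → Game

⊖_ : Game → Game
⊖ ⟨ GL ∣ GR ⟩ = ⟨ (λ j → ⊖ GR j) ∣ (λ i → ⊖ GL i) ⟩

_⊕_ : Game → Game → Game
G@(⟨ GL ∣ GR ⟩) ⊕ H@(⟨ HL ∣ HR ⟩) =
  ⟨ (λ i → GL i ⊕ H) ++ (λ i → G ⊕ HL i) ∣ (λ j → GR j ⊕ H) ++ (λ j → G ⊕ HR j) ⟩

_⊝_ : Game → Game → Game
G ⊝ H = G ⊕ (⊖ H)

LeftWinsMovingFirst LeftWinsMovingSecond : Game → Set
LeftWinsMovingFirst  ⟨ GL ∣ GR ⟩ = ∃[ i ] LeftWinsMovingSecond (GL i)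
LeftWinsMovingSecond ⟨ GL ∣ GR ⟩ = ∀ j → LeftWinsMovingFirst (GR j)

_≽_ _≈_ _≺_ : Rel Game 0ℓ
G ≽ H = LeftWinsMovingSecond (G ⊝ H)
G ≈ H = G ≽ H × H ≽ G
G ≺ H = H ≽ G × ¬ G ≽ H

naturalᴳ : ℕ → Game
naturalᴳ zero    = ⟨ [] ∣ [] ⟩
naturalᴳ (suc n) = ⟨ naturalᴳ n ∷ [] ∣ [] ⟩

integerᴳ : ℤ → Game
integerᴳ (+ n)    = naturalᴳ n
integerᴳ -[1+ n ] = ⊖ naturalᴳ (suc n)

-- The canonical form of m / 2 ^ k, not assumed to be in lowest terms: for
-- odd m it is { (m - 1) / 2 ^ k | (m + 1) / 2 ^ k }, whose options have
-- denominator dividing 2 ^ (k - 1).  Division by _/ℕ_ rounds down.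
dyadicᴳ : ℤ → ℕ → Game
dyadicᴳ m zero    = integerᴳ m
dyadicᴳ m (suc k) with m %ℕ 2
... | zero  = dyadicᴳ (m /ℕ 2) k
... | suc _ = ⟨ dyadicᴳ (m /ℕ 2) k ∷ [] ∣ dyadicᴳ (ℤ.suc (m /ℕ 2)) k ∷ [] ⟩

numberᴳ : ℤ[½] → Game
numberᴳ x = dyadicᴳ (↥ value x) ⌊log₂ ↧ₙ value x ⌋

EqualToInteger EqualToNumber Numberish : Game → Set
EqualToInteger G = ∃[ n ] G ≈ integerᴳ n
EqualToNumber  G = ∃[ x ] G ≈ numberᴳ x
Numberish      G = ∃[ x ] ∀ ε → integer 0ℤ < ε →
  (⊖ numberᴳ ε) ≺ (G ⊝ numberᴳ x) × (G ⊝ numberᴳ x) ≺ numberᴳ ε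

-- LeftStop G x and RightStop G x say that L(G) = x and R(G) = x.
data LeftStop  : Game → ℤ[½] → Set
data RightStop : Game → ℤ[½] → Set

data LeftStop where
  number    : ∀ {G x} → G ≈ numberᴳ x → LeftStop G x
  nonNumber : ∀ {m n} {GL : Vector Game (suc m)} {GR : Vector Game n} {r} →
              ¬ EqualToNumber ⟨ GL ∣ GR ⟩ →
              (∀ i → RightStop (GL i) (r i)) →
              LeftStop ⟨ GL ∣ GR ⟩ (max r)

data RightStop where
  number    : ∀ {G x} → G ≈ numberᴳ x → RightStop G x
  nonNumber : ∀ {m n} {GL : Vector Game m} {GR : Vector Game (suc n)} {l} →
              ¬ EqualToNumber ⟨ GL ∣ GR ⟩ →
              (∀ j → LeftStop (GR j) (l j)) →
              RightStop ⟨ GL ∣ GR ⟩ (min l)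

-- The definitions of λ_t(G), ρ_t(G), G_t and t(G) are recursive but not
-- visibly total, so they are functions of a proof of WellDefined G, which
-- says that every maximum, minimum and least element met while unfolding
-- the recursion from G exists.  A maximum or minimum over the options
-- exists exactly when there is an option.
data WellDefined : Game → Set

λₜ ρₜ : ∀ {G} → WellDefined G → ℤ[½] → ℤ[½]

λ̃ : ∀ {n} {GL : Vector Game (suc n)} → (∀ i → WellDefined (GL i)) → ℤ[½] → ℤ[½]
λ̃ dL t = max (λ i → ρₜ (dL i) t - t)

ρ̃ : ∀ {n} {GR : Vector Game (suc n)} → (∀ j → WellDefined (GR j)) → ℤ[½] → ℤ[½]
ρ̃ dR t = min (λ j → λₜ (dR j) t + t)

data WellDefined where
  isInteger  : ∀ {G} n → G ≈ integerᴳ n → WellDefined G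
  nonInteger : ∀ {m n} {GL : Vector Game (suc m)} {GR : Vector Game (suc n)} →
               ¬ EqualToInteger ⟨ GL ∣ GR ⟩ →
               (dL : ∀ i → WellDefined (GL i)) (dR : ∀ j → WellDefined (GR j)) →
               ∀ τ → IsLeast (λ t → λ̃ dL t ≡ ρ̃ dR t) τ →
               WellDefined ⟨ GL ∣ GR ⟩

λₜ (isInteger n _)            t = integer n
λₜ (nonInteger _ dL dR τ _) t = if does (t ≤? τ) then λ̃ dL t else λ̃ dL τ

ρₜ (isInteger n _)            t = integer n
ρₜ (nonInteger _ dL dR τ _) t = if does (t ≤? τ) then ρ̃ dR t else ρ̃ dR τ

cooled : ∀ {G} → WellDefined G → ℤ[½] → Game
cooled (isInteger n _)            t = integerᴳ n
cooled (nonInteger _ dL dR τ _) t =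
  if does (t ≤? τ)
  then ⟨ (λ i → cooled (dL i) t ⊝ numberᴳ t) ∣ (λ j → cooled (dR j) t ⊕ numberᴳ t) ⟩
  else numberᴳ (λ̃ dL τ)

-- ⊥₋ is -∞.
temperature : ∀ {G} → WellDefined G → ℤ[½] ₋
temperature (isInteger _ _)        = ⊥₋
temperature (nonInteger _ _ _ τ _) = [ τ ]

line : ℤ → ℤ[½] → ℤ[½] → ℤ[½]
line a b x = integer a * x + b

-- Degenerate middle pieces (repeated breakpoints) are allowed.
record DiadicTrajectory (f : ℤ[½] → ℤ[½]) : Set where
  field
    n        : ℕ
    j        : Vector ℤ[½] (suc n)
    a        : Vector ℤ (suc (suc n))
    b        : Vector ℤ[½] (suc (suc n))
    a∈       : ∀ i → a i ∈ -1ℤ List.∷ 0ℤ List.∷ 1ℤ List.∷ List.[]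
    j-sorted : ∀ (i : Fin n) → j (inject₁ i) ≤ j (suc i)
    first    : ∀ x → x ≤ j zero → f x ≡ line (a zero) (b zero) x
    middle   : ∀ (i : Fin n) x → j (inject₁ i) ≤ x → x ≤ j (suc i) →
               f x ≡ line (a (suc (inject₁ i))) (b (suc (inject₁ i))) x
    last     : ∀ x → j (fromℕ n) ≤ x → f x ≡ line (a (fromℕ (suc n))) (b (fromℕ (suc n))) x
    joined   : ∀ (i : Fin (suc n)) →
               line (a (inject₁ i)) (b (inject₁ i)) (j i) ≡ line (a (suc i)) (b (suc i)) (j i)

HasSlopesIn : List ℤ → (ℤ[½] → ℤ[½]) → Set
HasSlopesIn A f = Σ[ T ∈ DiadicTrajectory f ] ∀ i → DiadicTrajectory.a T i ∈ A

HasMastValue : (ℤ[½] → ℤ[½]) → ℤ[½] → Set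
HasMastValue f v = Σ[ T ∈ DiadicTrajectory f ] let open DiadicTrajectory T in
  a (fromℕ (suc n)) ≡ 0ℤ × b (fromℕ (suc n)) ≡ v

{-# OPTIONS --safe #-}
module Submission where

-- λ and -ρ have slopes in {0, -1}, and this class of functions is closed under
-- maxima, under truncation, and under f ↦ -(f + t), which turns -ρ of the left
-- options and λ of the right options into the terms of λ̃ and -ρ̃.  So λ̃ - ρ̃ is
-- nonincreasing, piecewise linear and finally negative.  At t = -1 the recursion
-- computes ρ = the largest integer ≤ G and λ = the least integer ≥ G: it imitates
-- that of the stops with integers in place of numbers.  By the simplicity theorem
-- λ̃ ≤ ρ̃ at t = -1 would therefore make G an integer, so the first meeting point
-- of λ̃ and ρ̃ exists and lies beyond -1.  Up to that point ρ̃ ≤ λ̃, and then the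
-- stops of a game can be read off its options whether or not it is a number.

open import Defs
import Algebra.Construct.NaturalChoice.Max
import Algebra.Construct.NaturalChoice.Min
import Algebra.Properties.AbelianGroup
open import Algebra.Bundles using (AbelianGroup)
open import Data.Bool.Base using (if_then_else_)
open import Data.Fin.Base using (Fin; zero; suc; inject₁; fromℕ; splitAt; _↑ˡ_; _↑ʳ_)
open import Data.Integer.Base as ℤ using (ℤ; +_; -[1+_]; 0ℤ; 1ℤ; -1ℤ)
open import Data.Integer.DivMod using (_/ℕ_; _%ℕ_; a≡a%ℕn+[a/ℕn]*n; n%ℕd<d)
open import Data.Integer.GCD using (gcd)
import Data.Integer.Properties as ℤ
open import Data.Integer.Tactic.RingSolver using (solve-∀)
open import Data.Irrelevant using ([_])
open import Data.List.Base using (List; []; _∷_)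
open import Data.List.Membership.Propositional using (_∈_)
open import Data.List.Relation.Unary.Any using (here; there)
open import Data.Nat.Base as ℕ using (ℕ; zero; suc; _^_)
open import Data.Nat.Divisibility using (divides)
open import Data.Nat.Logarithm using (⌊log₂_⌋; ⌊log₂[2^n]⌋≡n)
import Data.Nat.Properties as ℕ
open import Data.Product.Base using (∃-syntax; _×_; _,_; proj₁; proj₂)
open import Data.Rational.Base as ℚ using (↥_; ↧_; ↧ₙ_)
open import Data.Rational.Literals using (fromℤ)
import Data.Rational.Properties as ℚ
import Data.Rational.Unnormalised.Base as ℚᵘ
import Data.Rational.Unnormalised.Properties as ℚᵘ
open import Data.Refinement.Base using (value; _,_)
open import Data.Sum.Base as Sum using (_⊎_; inj₁; inj₂; [_,_]′)
open import Data.Unit.Base using (⊤; tt)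
open import Data.Vec.Functional as Vec using (Vector; _++_)
open import Data.Vec.Functional.Properties using (lookup-++ˡ; lookup-++ʳ)
open import Data.Vec.Functional.Relation.Unary.All.Properties using (++⁺; ++⁻ˡ; ++⁻ʳ)
open import Data.Vec.Functional.Relation.Unary.Any using (Any)
open import Function.Base using (_∘_)
open import Level using (0ℓ)
open import Relation.Binary.Bundles using (DecTotalOrder)
open import Relation.Binary.Construct.Add.Infimum.Strict _<_ using (_<₋_; [<]-injective; [_])
open import Relation.Binary.PropositionalEquality using (_≡_; _≢_; refl; sym; trans; cong; cong₂;
                                                         subst; subst₂; isEquivalence)
open import Relation.Nullary using (¬_; Dec; yes; no; does)
open import Relation.Nullary.Construct.Add.Infimum using ([_]; []-injective)
open import Relation.Nullary.Decidable using (recompute)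
open import Relation.Nullary.Negation using (contradiction)

-- The ordered group of games

-- The stops are defined by recursion on the form of a game, with a case distinction on being a
-- number, while the options of a cooled game are sums with a number. This is why stops are handled
-- through the order: `IsLeftStop` and `IsRightStop` say which numbers lie below and above a game,
-- so that translation by a number rearranges inequalities; uniqueness recovers the recursive stops
-- at the end.
--
-- The functions λ and ρ take a derivation of well-definedness as argument. Facts about thermographs
-- are therefore proved for every derivation, by induction on it, and then applied to the
-- derivations of the options in order to build that of the game.
--
-- The constant -1 arises as follows. An integer k fits strictly between the options of G exactly if
-- floor(G^L) + 1 ≤ k ≤ ceiling(G^R) - 1 for all of them, and these shifts by 1 are the tax at t =
-- -1. Hence λ̃ ≤ ρ̃ there is equivalent to G being an integer, and this equivalence decides which
-- clause of the recursion applies.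

infix 4 _≤ᴳ_ _⧏_ _≃_

leftArity rightArity : Game → ℕ
leftArity  (⟨_∣_⟩ {m} _ _) = m
rightArity (⟨_∣_⟩ {n = n} _ _) = n

left : ∀ G → Vector Game (leftArity G)
left ⟨ GL ∣ _ ⟩ = GL

right : ∀ G → Vector Game (rightArity G)
right ⟨ _ ∣ GR ⟩ = GR

-- Conway's recursive order. It compares options directly instead of playing the difference game,
-- and `G ⧏ H` states positively that `H ≤ᴳ G` fails, so that it carries the winning move as a
-- witness.
data _≤ᴳ_ (G H : Game) : Set
data _⧏_ (G H : Game) : Set

data _≤ᴳ_ G H where
  ≤-intro : (∀ i → left G i ⧏ H) → (∀ j → G ⧏ right H j) → G ≤ᴳ H

data _⧏_ G H where
  viaLeft  : ∀ i → G ≤ᴳ left H i → G ⧏ H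
  viaRight : ∀ j → right G j ≤ᴳ H → G ⧏ H

_≃_ : Game → Game → Set
G ≃ H = G ≤ᴳ H × H ≤ᴳ G

left⧏ : ∀ {G H} → G ≤ᴳ H → ∀ i → left G i ⧏ H
left⧏ (≤-intro l _) = l

⧏right : ∀ {G H} → G ≤ᴳ H → ∀ j → G ⧏ right H j
⧏right (≤-intro _ r) = r

≤ᴳ-refl : ∀ {G} → G ≤ᴳ G
≤ᴳ-refl {⟨ GL ∣ GR ⟩} = ≤-intro (λ i → viaLeft i (≤ᴳ-refl {GL i}))
    (λ j → viaRight j (≤ᴳ-refl {GR j}))

≤ᴳ-trans : ∀ {G H K} → G ≤ᴳ H → H ≤ᴳ K → G ≤ᴳ K
⧏-≤ᴳ-trans : ∀ {G H K} → G ⧏ H → H ≤ᴳ K → G ⧏ K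
≤ᴳ-⧏-trans : ∀ {G H K} → G ≤ᴳ H → H ⧏ K → G ⧏ K
≤ᴳ-trans G≤H@(≤-intro l _) H≤K@(≤-intro _ r) =
  ≤-intro (λ i → ⧏-≤ᴳ-trans (l i) H≤K) (λ j → ≤ᴳ-⧏-trans G≤H (r j))
⧏-≤ᴳ-trans (viaLeft i G≤)  (≤-intro l _) = ≤ᴳ-⧏-trans G≤ (l i)
⧏-≤ᴳ-trans (viaRight j ≤H) H≤K           = viaRight j (≤ᴳ-trans ≤H H≤K)
≤ᴳ-⧏-trans G≤H           (viaLeft i H≤)  = viaLeft i (≤ᴳ-trans G≤H H≤)
≤ᴳ-⧏-trans (≤-intro _ r) (viaRight j ≤K) = ⧏-≤ᴳ-trans (r j) ≤K

≤ᴳ⇒¬⧏ : ∀ {G H} → G ≤ᴳ H → ¬ H ⧏ G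
≤ᴳ⇒¬⧏ (≤-intro l _) (viaLeft i H≤)  = ≤ᴳ⇒¬⧏ H≤ (l i)
≤ᴳ⇒¬⧏ (≤-intro _ r) (viaRight j ≤G) = ≤ᴳ⇒¬⧏ ≤G (r j)

all⊎any : ∀ {n} {P Q : Fin n → Set} → (∀ i → P i ⊎ Q i) → (∀ i → P i) ⊎ (∃[ i ] Q i)
all⊎any {zero}  d = inj₁ λ ()
all⊎any {suc n} d with d zero | all⊎any (d ∘ suc)
... | inj₂ q | _            = inj₂ (zero , q)
... | inj₁ _ | inj₂ (i , q) = inj₂ (suc i , q)
... | inj₁ p | inj₁ ps      = inj₁ λ { zero → p ; (suc i) → ps i }

-- Games are finite, so the order is decidable; later case distinctions on how two games compare
-- rest on this.
≤ᴳ⊎⧏ : ∀ G H → G ≤ᴳ H ⊎ H ⧏ G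
≤ᴳ⊎⧏ G@(⟨ GL ∣ GR ⟩) H@(⟨ HL ∣ HR ⟩)
  with all⊎any (λ i → Sum.swap (≤ᴳ⊎⧏ H (GL i))) | all⊎any (λ j → Sum.swap (≤ᴳ⊎⧏ (HR j) G))
... | inj₂ (i , H≤) | _             = inj₂ (viaLeft i H≤)
... | inj₁ _        | inj₂ (j , ≤G) = inj₂ (viaRight j ≤G)
... | inj₁ l        | inj₁ r        = inj₁ (≤-intro l r)

left-⧏ : ∀ G i → left G i ⧏ G
left-⧏ G i = viaLeft i ≤ᴳ-refl

⧏-right : ∀ G j → G ⧏ right G j
⧏-right G j = viaRight j ≤ᴳ-refl

any-++⁻ : ∀ (P : Game → Set) {m n} (xs : Vector Game m) {ys : Vector Game n} →
          Any P (xs ++ ys) → Any P xs ⊎ Any P ys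
any-++⁻ P {m} xs (k , p) with splitAt m k
... | inj₁ i = inj₁ (i , p)
... | inj₂ j = inj₂ (j , p)

any-++⁺ˡ : ∀ (P : Game → Set) {m n} (xs : Vector Game m) (ys : Vector Game n) →
           Any P xs → Any P (xs ++ ys)
any-++⁺ˡ P {n = n} xs ys (i , p) = i ↑ˡ n , subst P (sym (lookup-++ˡ xs ys i)) p

any-++⁺ʳ : ∀ (P : Game → Set) {m n} (xs : Vector Game m) (ys : Vector Game n) →
           Any P ys → Any P (xs ++ ys)
any-++⁺ʳ P {m} xs ys (j , p) = m ↑ʳ j , subst P (sym (lookup-++ʳ xs ys j)) p

-- A move in `G ⊝ H` is a move in G or a negated move in H, and these are the two clauses of the
-- recursive order; `++` lists the former first.
≽⇒≤ᴳ : ∀ {G H} → G ≽ H → H ≤ᴳ G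
first⇒⧏ : ∀ {G H} → LeftWinsMovingFirst (G ⊝ H) → H ⧏ G
≽⇒≤ᴳ {G@(⟨ GL ∣ GR ⟩)} {H@(⟨ HL ∣ HR ⟩)} w = ≤-intro
  (λ i → first⇒⧏ {G} {HL i} (++⁻ʳ LeftWinsMovingFirst (λ j → GR j ⊝ H) w i))
  (λ j → first⇒⧏ {GR j} {H} (++⁻ˡ LeftWinsMovingFirst (λ j → GR j ⊝ H) w j))
first⇒⧏ {G@(⟨ GL ∣ GR ⟩)} {H@(⟨ HL ∣ HR ⟩)} w = Sum.[
  (λ (i , w′) → viaLeft i (≽⇒≤ᴳ {GL i} {H} w′)) ,
  (λ (j , w′) → viaRight j (≽⇒≤ᴳ {G} {HR j} w′)) ]
  (any-++⁻ LeftWinsMovingSecond (λ i → GL i ⊝ H) w)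

≤ᴳ⇒≽ : ∀ {G H} → H ≤ᴳ G → G ≽ H
⧏⇒first : ∀ {G H} → H ⧏ G → LeftWinsMovingFirst (G ⊝ H)
≤ᴳ⇒≽ {G@(⟨ GL ∣ GR ⟩)} {H@(⟨ HL ∣ HR ⟩)} (≤-intro l r) = ++⁺ LeftWinsMovingFirst
  (λ j → ⧏⇒first {GR j} {H} (r j)) (λ i → ⧏⇒first {G} {HL i} (l i))
⧏⇒first {G@(⟨ GL ∣ GR ⟩)} {H@(⟨ HL ∣ HR ⟩)} (viaLeft i H≤) =
  any-++⁺ˡ LeftWinsMovingSecond (λ i → GL i ⊝ H) _ (i , ≤ᴳ⇒≽ {GL i} {H} H≤)
⧏⇒first {G@(⟨ GL ∣ GR ⟩)} {H@(⟨ HL ∣ HR ⟩)} (viaRight j ≤G) =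
  any-++⁺ʳ LeftWinsMovingSecond (λ i → GL i ⊝ H) _ (j , ≤ᴳ⇒≽ {G} {HR j} ≤G)

≈⇒≃ : ∀ {G H} → G ≈ H → G ≃ H
≈⇒≃ {G} {H} (G≽H , H≽G) = ≽⇒≤ᴳ {H} {G} H≽G , ≽⇒≤ᴳ {G} {H} G≽H

≃⇒≈ : ∀ {G H} → G ≃ H → G ≈ H
≃⇒≈ {G} {H} (G≤H , H≤G) = ≤ᴳ⇒≽ {G} {H} H≤G , ≤ᴳ⇒≽ {H} {G} G≤H

≃-refl : ∀ {G} → G ≃ G
≃-refl = ≤ᴳ-refl , ≤ᴳ-refl

≃-reflexive : ∀ {G H} → G ≡ H → G ≃ H
≃-reflexive refl = ≃-refl

≃-sym : ∀ {G H} → G ≃ H → H ≃ G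
≃-sym (p , q) = q , p

≃-trans : ∀ {G H K} → G ≃ H → H ≃ K → G ≃ K
≃-trans (p , q) (p′ , q′) = ≤ᴳ-trans p p′ , ≤ᴳ-trans q′ q

≃? : ∀ G H → Dec (G ≃ H)
≃? G H with ≤ᴳ⊎⧏ G H | ≤ᴳ⊎⧏ H G
... | inj₁ p | inj₁ q = yes (p , q)
... | inj₂ p | _      = no λ (q , _) → ≤ᴳ⇒¬⧏ q p
... | _      | inj₂ p = no λ (_ , q) → ≤ᴳ⇒¬⧏ q p

left-⊕ : ∀ (P : Game → Set) G H → (∀ i → P (left G i ⊕ H)) → (∀ i → P (G ⊕ left H i)) →
         ∀ k → P (left (G ⊕ H) k)
left-⊕ P ⟨ _ ∣ _ ⟩ ⟨ _ ∣ _ ⟩ = ++⁺ P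

right-⊕ : ∀ (P : Game → Set) G H → (∀ j → P (right G j ⊕ H)) → (∀ j → P (G ⊕ right H j)) →
          ∀ k → P (right (G ⊕ H) k)
right-⊕ P ⟨ _ ∣ _ ⟩ ⟨ _ ∣ _ ⟩ = ++⁺ P

⧏-⊕-leftˡ : ∀ {X} G H i → X ≤ᴳ left G i ⊕ H → X ⧏ G ⊕ H
⧏-⊕-leftˡ {X} G@(⟨ GL ∣ _ ⟩) H@(⟨ HL ∣ _ ⟩) i p =
  let k , q = any-++⁺ˡ (X ≤ᴳ_) (λ i → GL i ⊕ H) (λ i → G ⊕ HL i) (i , p) in viaLeft k q

⧏-⊕-leftʳ : ∀ {X} G H i → X ≤ᴳ G ⊕ left H i → X ⧏ G ⊕ H
⧏-⊕-leftʳ {X} G@(⟨ GL ∣ _ ⟩) H@(⟨ HL ∣ _ ⟩) i p =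
  let k , q = any-++⁺ʳ (X ≤ᴳ_) (λ i → GL i ⊕ H) (λ i → G ⊕ HL i) (i , p) in viaLeft k q

⊕-⧏-rightˡ : ∀ {X} G H j → right G j ⊕ H ≤ᴳ X → G ⊕ H ⧏ X
⊕-⧏-rightˡ {X} G@(⟨ _ ∣ GR ⟩) H@(⟨ _ ∣ HR ⟩) j p =
  let k , q = any-++⁺ˡ (_≤ᴳ X) (λ j → GR j ⊕ H) (λ j → G ⊕ HR j) (j , p) in viaRight k q

⊕-⧏-rightʳ : ∀ {X} G H j → G ⊕ right H j ≤ᴳ X → G ⊕ H ⧏ X
⊕-⧏-rightʳ {X} G@(⟨ _ ∣ GR ⟩) H@(⟨ _ ∣ HR ⟩) j p =
  let k , q = any-++⁺ʳ (_≤ᴳ X) (λ j → GR j ⊕ H) (λ j → G ⊕ HR j) (j , p) in viaRight k q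

⊕-monoˡ : ∀ {G H} K → G ≤ᴳ H → G ⊕ K ≤ᴳ H ⊕ K
⊕-monoˡ-⧏ : ∀ {G H} K → G ⧏ H → G ⊕ K ⧏ H ⊕ K
⊕-monoˡ {G} {H} K@(⟨ KL ∣ KR ⟩) G≤H@(≤-intro l r) = ≤-intro
  (left-⊕ (_⧏ H ⊕ K) G K (λ i → ⊕-monoˡ-⧏ K (l i))
    (λ i → ⧏-⊕-leftʳ H K i (⊕-monoˡ (KL i) G≤H)))
  (right-⊕ (G ⊕ K ⧏_) H K (λ j → ⊕-monoˡ-⧏ K (r j))
    (λ j → ⊕-⧏-rightʳ G K j (⊕-monoˡ (KR j) G≤H)))
⊕-monoˡ-⧏ {G} {H} K (viaLeft i G≤)  = ⧏-⊕-leftˡ H K i (⊕-monoˡ K G≤)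
⊕-monoˡ-⧏ {G} {H} K (viaRight j ≤H) = ⊕-⧏-rightˡ G K j (⊕-monoˡ K ≤H)

⊕-comm-≤ : ∀ G H → G ⊕ H ≤ᴳ H ⊕ G
⊕-comm-≤ G@(⟨ GL ∣ GR ⟩) H@(⟨ HL ∣ HR ⟩) = ≤-intro
  (left-⊕ (_⧏ H ⊕ G) G H (λ i → ⧏-⊕-leftʳ H G i (⊕-comm-≤ (GL i) H))
    (λ i → ⧏-⊕-leftˡ H G i (⊕-comm-≤ G (HL i))))
  (right-⊕ (G ⊕ H ⧏_) H G (λ j → ⊕-⧏-rightʳ G H j (⊕-comm-≤ G (HR j)))
    (λ j → ⊕-⧏-rightˡ G H j (⊕-comm-≤ (GR j) H)))

⊕-comm : ∀ G H → G ⊕ H ≃ H ⊕ G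
⊕-comm G H = ⊕-comm-≤ G H , ⊕-comm-≤ H G

⊕-monoʳ : ∀ {G H} K → G ≤ᴳ H → K ⊕ G ≤ᴳ K ⊕ H
⊕-monoʳ {G} {H} K G≤H =
  ≤ᴳ-trans (⊕-comm-≤ K G) (≤ᴳ-trans (⊕-monoˡ K G≤H) (⊕-comm-≤ H K))

⊕-monoʳ-⧏ : ∀ {G H} K → G ⧏ H → K ⊕ G ⧏ K ⊕ H
⊕-monoʳ-⧏ {G} {H} K G⧏H =
  ≤ᴳ-⧏-trans (⊕-comm-≤ K G) (⧏-≤ᴳ-trans (⊕-monoˡ-⧏ K G⧏H) (⊕-comm-≤ H K))

⊕-mono : ∀ {G H K M} → G ≤ᴳ H → K ≤ᴳ M → G ⊕ K ≤ᴳ H ⊕ M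
⊕-mono {H = H} {K} p q = ≤ᴳ-trans (⊕-monoˡ K p) (⊕-monoʳ H q)

⊕-assoc-≤ : ∀ G H K → (G ⊕ H) ⊕ K ≤ᴳ G ⊕ (H ⊕ K)
⊕-assoc-≤ G@(⟨ GL ∣ GR ⟩) H@(⟨ HL ∣ HR ⟩) K@(⟨ KL ∣ KR ⟩) = ≤-intro
  (left-⊕ (_⧏ G ⊕ (H ⊕ K)) (G ⊕ H) K
    (left-⊕ (λ X → X ⊕ K ⧏ G ⊕ (H ⊕ K)) G H
      (λ i → ⧏-⊕-leftˡ G (H ⊕ K) i (⊕-assoc-≤ (GL i) H K))
      (λ i → ≤ᴳ-⧏-trans (⊕-assoc-≤ G (HL i) K) (⊕-monoʳ-⧏ G (⧏-⊕-leftˡ H K i ≤ᴳ-refl))))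
    (λ i → ≤ᴳ-⧏-trans (⊕-assoc-≤ G H (KL i)) (⊕-monoʳ-⧏ G (⧏-⊕-leftʳ H K i ≤ᴳ-refl))))
  (right-⊕ ((G ⊕ H) ⊕ K ⧏_) G (H ⊕ K)
    (λ j → ⧏-≤ᴳ-trans (⊕-monoˡ-⧏ K (⊕-⧏-rightˡ G H j ≤ᴳ-refl)) (⊕-assoc-≤ (GR j) H K))
    (right-⊕ (λ X → (G ⊕ H) ⊕ K ⧏ G ⊕ X) H K
      (λ j → ⧏-≤ᴳ-trans (⊕-monoˡ-⧏ K (⊕-⧏-rightʳ G H j ≤ᴳ-refl)) (⊕-assoc-≤ G (HR j) K))
      (λ j → ⊕-⧏-rightʳ (G ⊕ H) K j (⊕-assoc-≤ G H (KR j)))))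

⊕-cong : ∀ {G H K M} → G ≃ H → K ≃ M → G ⊕ K ≃ H ⊕ M
⊕-cong (p , p′) (q , q′) = ⊕-mono p q , ⊕-mono p′ q′

-- The other half of associativity is the first half conjugated by commutativity.
⊕-assoc : ∀ G H K → (G ⊕ H) ⊕ K ≃ G ⊕ (H ⊕ K)
⊕-assoc G H K = ⊕-assoc-≤ G H K ,
  ≤ᴳ-trans (⊕-comm-≤ G (H ⊕ K)) (≤ᴳ-trans (⊕-monoˡ G (⊕-comm-≤ H K))
  (≤ᴳ-trans (⊕-assoc-≤ K H G) (≤ᴳ-trans (⊕-comm-≤ K (H ⊕ G)) (⊕-monoˡ K (⊕-comm-≤ H G)))))

0ᴳ : Game
0ᴳ = naturalᴳ 0

⊕-identityʳ : ∀ G → G ⊕ 0ᴳ ≃ G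
⊕-identityʳ G@(⟨ GL ∣ GR ⟩) =
  ≤-intro (left-⊕ (_⧏ G) G 0ᴳ (λ i → viaLeft i (proj₁ (⊕-identityʳ (GL i)))) λ ())
          (λ j → ⊕-⧏-rightˡ G 0ᴳ j (proj₁ (⊕-identityʳ (GR j)))) ,
  ≤-intro (λ i → ⧏-⊕-leftˡ G 0ᴳ i (proj₂ (⊕-identityʳ (GL i))))
          (right-⊕ (G ⧏_) G 0ᴳ (λ j → viaRight j (proj₂ (⊕-identityʳ (GR j)))) λ ())

⊖-anti : ∀ {G H} → G ≤ᴳ H → ⊖ H ≤ᴳ ⊖ G
⊖-anti-⧏ : ∀ {G H} → G ⧏ H → ⊖ H ⧏ ⊖ G
⊖-anti {⟨ _ ∣ _ ⟩} {⟨ _ ∣ _ ⟩} (≤-intro l r) =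
  ≤-intro (λ j → ⊖-anti-⧏ (r j)) (λ i → ⊖-anti-⧏ (l i))
⊖-anti-⧏ {G@(⟨ _ ∣ _ ⟩)} {⟨ _ ∣ _ ⟩} (viaLeft i p)  = viaRight i (⊖-anti p)
⊖-anti-⧏ {⟨ _ ∣ _ ⟩} {H@(⟨ _ ∣ _ ⟩)} (viaRight j p) = viaLeft j (⊖-anti p)

⊖-cong : ∀ {G H} → G ≃ H → ⊖ G ≃ ⊖ H
⊖-cong (p , q) = ⊖-anti q , ⊖-anti p

-- The mirror strategy: a move in either summand is answered by its copy in the other.
⊕-inverseʳ-≤ : ∀ G → G ⊝ G ≤ᴳ 0ᴳ
⊕-inverseʳ-≤ G@(⟨ GL ∣ GR ⟩) = ≤-intro (left-⊕ (_⧏ 0ᴳ) G (⊖ G)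
  (λ i → ⊕-⧏-rightʳ (GL i) (⊖ G) i (⊕-inverseʳ-≤ (GL i)))
  (λ j → ⊕-⧏-rightˡ G (⊖ GR j) j (⊕-inverseʳ-≤ (GR j)))) λ ()

⊕-inverseʳ-≥ : ∀ G → 0ᴳ ≤ᴳ G ⊝ G
⊕-inverseʳ-≥ G@(⟨ GL ∣ GR ⟩) = ≤-intro (λ ()) (right-⊕ (0ᴳ ⧏_) G (⊖ G)
  (λ j → ⧏-⊕-leftʳ (GR j) (⊖ G) j (⊕-inverseʳ-≥ (GR j)))
  (λ i → ⧏-⊕-leftˡ G (⊖ GL i) i (⊕-inverseʳ-≥ (GL i))))

⊕-inverseʳ : ∀ G → G ⊝ G ≃ 0ᴳ
⊕-inverseʳ G = ⊕-inverseʳ-≤ G , ⊕-inverseʳ-≥ G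

⊕-abelianGroup : AbelianGroup 0ℓ 0ℓ
⊕-abelianGroup = record
  { Carrier = Game ; _≈_ = _≃_ ; _∙_ = _⊕_ ; ε = 0ᴳ ; _⁻¹ = ⊖_
  ; isAbelianGroup = record
    { isGroup = record
      { isMonoid = record
        { isSemigroup = record
          { isMagma = record
            { isEquivalence = record { refl = ≃-refl ; sym = ≃-sym ; trans = ≃-trans }
            ; ∙-cong = ⊕-cong }
          ; assoc = ⊕-assoc }
        ; identity = (λ G → ≃-trans (⊕-comm 0ᴳ G) (⊕-identityʳ G)) , ⊕-identityʳ }
      ; inverse = (λ G → ≃-trans (⊕-comm (⊖ G) G) (⊕-inverseʳ G)) , ⊕-inverseʳ
      ; ⁻¹-cong = ⊖-cong }
    ; comm = ⊕-comm } }

-- Numbers as games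

naturalᴳ-≤-suc : ∀ n → naturalᴳ n ≤ᴳ naturalᴳ (suc n)
naturalᴳ-≤-suc zero    = ≤-intro (λ ()) (λ ())
naturalᴳ-≤-suc (suc n) = ≤-intro (λ { zero → viaLeft zero (naturalᴳ-≤-suc n) }) (λ ())

⊖0ᴳ : ⊖ 0ᴳ ≃ 0ᴳ
⊖0ᴳ = ≤-intro (λ ()) (λ ()) , ≤-intro (λ ()) (λ ())

integerᴳ-≤-suc : ∀ m → integerᴳ m ≤ᴳ integerᴳ (ℤ.suc m)
integerᴳ-≤-suc (+ n)          = naturalᴳ-≤-suc n
integerᴳ-≤-suc -[1+ zero ]    = ≤-intro (λ ()) (λ ())
integerᴳ-≤-suc -[1+ suc n ]   = ⊖-anti (naturalᴳ-≤-suc (suc n))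

integerᴳ-⧏-suc : ∀ m → integerᴳ m ⧏ integerᴳ (ℤ.suc m)
integerᴳ-⧏-suc (+ n)          = viaLeft zero ≤ᴳ-refl
integerᴳ-⧏-suc -[1+ zero ]    = viaRight zero (proj₁ ⊖0ᴳ)
integerᴳ-⧏-suc -[1+ suc n ]   = viaRight zero ≤ᴳ-refl

-- The canonical form of (2 a + 1) / 2 ^ (k + 1).
between : ℤ → ℕ → Game
between a k = ⟨ dyadicᴳ a k Vec.∷ Vec.[] ∣ dyadicᴳ (ℤ.suc a) k Vec.∷ Vec.[] ⟩

-- `dyadicᴳ` branches on a remainder that does not reduce for a variable numerator. This view names
-- half the numerator, rounded down, so that `dyadicᴳ-even` and `dyadicᴳ-odd` can act as defining
-- equations.
data Parity : ℤ → Set where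
  even : ∀ a → Parity (+ 2 ℤ.* a)
  odd  : ∀ a → Parity (1ℤ ℤ.+ + 2 ℤ.* a)

parity : ∀ m → Parity m
parity m with m %ℕ 2 | n%ℕd<d m 2 | a≡a%ℕn+[a/ℕn]*n m 2
... | 0 | _ | eq = subst Parity (sym (trans eq (lemma (m /ℕ 2)))) (even (m /ℕ 2))
  where
  lemma : ∀ q → 0ℤ ℤ.+ q ℤ.* + 2 ≡ + 2 ℤ.* q
  lemma = solve-∀
... | 1 | _ | eq = subst Parity (sym (trans eq (lemma (m /ℕ 2)))) (odd (m /ℕ 2))
  where
  lemma : ∀ q → 1ℤ ℤ.+ q ℤ.* + 2 ≡ 1ℤ ℤ.+ + 2 ℤ.* q
  lemma = solve-∀
... | suc (suc _) | ℕ.s≤s (ℕ.s≤s ()) | _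

2*≢1 : ∀ a → + 2 ℤ.* a ≢ 1ℤ
2*≢1 a eq with ℤ.∣ a ∣ | trans (sym (ℤ.abs-* (+ 2) a)) (cong ℤ.∣_∣ eq)
... | zero  | ()
... | suc n | eq′ with trans (sym (ℕ.+-suc (suc n) (n ℕ.+ 0))) eq′
...   | ()

dyadicᴳ-even : ∀ a k → dyadicᴳ (+ 2 ℤ.* a) (suc k) ≡ dyadicᴳ a k
dyadicᴳ-even a k with (+ 2 ℤ.* a) %ℕ 2 | n%ℕd<d (+ 2 ℤ.* a) 2 | a≡a%ℕn+[a/ℕn]*n (+ 2 ℤ.* a) 2
... | 0 | _ | eq = cong (λ b → dyadicᴳ b k)
  (ℤ.*-cancelʳ-≡ _ a (+ 2) (sym (trans (ℤ.*-comm a (+ 2)) (trans eq (ℤ.+-identityˡ _)))))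
... | 1 | _ | eq = contradiction (trans (lemma a q) (trans (cong (ℤ._- q ℤ.* + 2) eq) (lemma′ q)))
    (2*≢1 (a ℤ.- q))
  where
  q = (+ 2 ℤ.* a) /ℕ 2
  lemma : ∀ a q → + 2 ℤ.* (a ℤ.- q) ≡ + 2 ℤ.* a ℤ.- q ℤ.* + 2
  lemma = solve-∀
  lemma′ : ∀ q → (1ℤ ℤ.+ q ℤ.* + 2) ℤ.- q ℤ.* + 2 ≡ 1ℤ
  lemma′ = solve-∀
... | suc (suc _) | ℕ.s≤s (ℕ.s≤s ()) | _

dyadicᴳ-odd : ∀ a k → dyadicᴳ (1ℤ ℤ.+ + 2 ℤ.* a) (suc k) ≡ between a k
dyadicᴳ-odd a k with (1ℤ ℤ.+ + 2 ℤ.* a) %ℕ 2 | n%ℕd<d (1ℤ ℤ.+ + 2 ℤ.* a) 2 | a≡a%ℕn+[a/ℕn]*n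
    (1ℤ ℤ.+ + 2 ℤ.* a) 2
... | 1 | _ | eq = cong (λ b → between b k)
  (ℤ.*-cancelʳ-≡ _ a (+ 2) (sym (trans (ℤ.*-comm a (+ 2))
      (trans (sym (ℤ.pred-suc _)) (trans (cong ℤ.pred eq) (ℤ.pred-suc _))))))
... | 0 | _ | eq = contradiction (trans (lemma a q) (trans (cong (ℤ._-_ (1ℤ ℤ.+ q ℤ.* + 2)) eq)
    (lemma′ q))) (2*≢1 (q ℤ.- a))
  where
  q = (1ℤ ℤ.+ + 2 ℤ.* a) /ℕ 2
  lemma : ∀ a q → + 2 ℤ.* (q ℤ.- a) ≡ (1ℤ ℤ.+ q ℤ.* + 2) ℤ.- (1ℤ ℤ.+ + 2 ℤ.* a)
  lemma = solve-∀
  lemma′ : ∀ q → (1ℤ ℤ.+ q ℤ.* + 2) ℤ.- (0ℤ ℤ.+ q ℤ.* + 2) ≡ 1ℤ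
  lemma′ = solve-∀
... | suc (suc _) | ℕ.s≤s (ℕ.s≤s ()) | _

dyadicᴳ-odd-suc : ∀ a k → dyadicᴳ (ℤ.suc (1ℤ ℤ.+ + 2 ℤ.* a)) (suc k) ≡ dyadicᴳ (ℤ.suc a) k
dyadicᴳ-odd-suc a k = trans (cong (λ m → dyadicᴳ m (suc k)) (lemma a)) (dyadicᴳ-even (ℤ.suc a) k)
  where
  lemma : ∀ a → 1ℤ ℤ.+ (1ℤ ℤ.+ + 2 ℤ.* a) ≡ + 2 ℤ.* (1ℤ ℤ.+ a)
  lemma = solve-∀

suc-pred-dyadicᴳ : ∀ m k → dyadicᴳ (ℤ.suc (ℤ.pred m)) k ≡ dyadicᴳ m k
suc-pred-dyadicᴳ m k = cong (λ m → dyadicᴳ m k) (ℤ.suc-pred m)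

-- Level k is the grid of multiples of 1/2^k. The last two fields say that options lie at least one
-- full step away. The induction depends on them, because an even numerator at level k + 1 inherits
-- its options from level k, where a step is twice as long.
record Spaced (k : ℕ) : Set where
  field
    ≤-suc       : ∀ m → dyadicᴳ m k ≤ᴳ dyadicᴳ (ℤ.suc m) k
    ⧏-suc       : ∀ m → dyadicᴳ m k ⧏ dyadicᴳ (ℤ.suc m) k
    left≤pred   : ∀ m i → left (dyadicᴳ m k) i ≤ᴳ dyadicᴳ (ℤ.pred m) k
    suc≤right   : ∀ m j → dyadicᴳ (ℤ.suc m) k ≤ᴳ right (dyadicᴳ m k) j

  pred-≤ : ∀ m → dyadicᴳ (ℤ.pred m) k ≤ᴳ dyadicᴳ m k
  pred-≤ m = subst (dyadicᴳ (ℤ.pred m) k ≤ᴳ_) (suc-pred-dyadicᴳ m k) (≤-suc (ℤ.pred m))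

spaced : ∀ k → Spaced k
spaced zero = record
  { ≤-suc = integerᴳ-≤-suc
  ; ⧏-suc = integerᴳ-⧏-suc
  ; left≤pred = λ { (+ suc n) zero → ≤ᴳ-refl }
  ; suc≤right = λ { (+ zero) () ; (+ suc n) () ; -[1+ zero ] zero → proj₂ ⊖0ᴳ ; -[1+ suc n ] zero
      → ≤ᴳ-refl } }
spaced (suc k) = record
  { ≤-suc = λ m → ≤-suc′ (parity m)
  ; ⧏-suc = λ m → ⧏-suc′ (parity m)
  ; left≤pred = λ m → left≤pred′ (parity m)
  ; suc≤right = λ m → suc≤right′ (parity m) }
  where
  open Spaced (spaced k)

  ≤-suc′ : ∀ {m} → Parity m → dyadicᴳ m (suc k) ≤ᴳ dyadicᴳ (ℤ.suc m) (suc k)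
  ≤-suc′ (even a) = subst₂ _≤ᴳ_ (sym (dyadicᴳ-even a k)) (sym (dyadicᴳ-odd a k))
    (≤-intro (λ i → viaLeft zero (≤ᴳ-trans (left≤pred a i) (pred-≤ a))) (λ { zero → ⧏-suc a }))
  ≤-suc′ (odd a) = subst₂ _≤ᴳ_ (sym (dyadicᴳ-odd a k)) (sym (dyadicᴳ-odd-suc a k))
    (≤-intro (λ { zero → ⧏-suc a })
             (λ j → viaRight zero (≤ᴳ-trans (≤-suc (ℤ.suc a)) (suc≤right (ℤ.suc a) j))))

  ⧏-suc′ : ∀ {m} → Parity m → dyadicᴳ m (suc k) ⧏ dyadicᴳ (ℤ.suc m) (suc k)
  ⧏-suc′ (even a) = subst₂ _⧏_ (sym (dyadicᴳ-even a k)) (sym (dyadicᴳ-odd a k))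
      (left-⧏ (between a k) zero)
  ⧏-suc′ (odd a)  = subst₂ _⧏_ (sym (dyadicᴳ-odd a k)) (sym (dyadicᴳ-odd-suc a k))
      (⧏-right (between a k) zero)

  left≤pred′ : ∀ {m} → Parity m → ∀ i → left (dyadicᴳ m (suc k)) i ≤ᴳ dyadicᴳ (ℤ.pred m) (suc k)
  left≤pred′ (even a) = subst (λ X → ∀ i → left X i ≤ᴳ dyadicᴳ (ℤ.pred (+ 2 ℤ.* a)) (suc k))
      (sym (dyadicᴳ-even a k))
    (λ i → ≤ᴳ-trans (left≤pred a i) (subst₂ _≤ᴳ_ (dyadicᴳ-even (ℤ.pred a) k)
      (cong (λ m → dyadicᴳ m (suc k)) (lemma a)) (≤-suc′ (even (ℤ.pred a)))))
    where
    lemma : ∀ a → 1ℤ ℤ.+ + 2 ℤ.* (-1ℤ ℤ.+ a) ≡ -1ℤ ℤ.+ + 2 ℤ.* a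
    lemma = solve-∀
  left≤pred′ (odd a) = subst (λ X → ∀ i → left X i ≤ᴳ dyadicᴳ (ℤ.pred (1ℤ ℤ.+ + 2 ℤ.* a)) (suc k))
      (sym (dyadicᴳ-odd a k))
    (λ { zero → proj₁ (≃-reflexive (trans (sym (dyadicᴳ-even a k))
      (cong (λ m → dyadicᴳ m (suc k)) (sym (ℤ.pred-suc (+ 2 ℤ.* a)))))) })

  suc≤right′ : ∀ {m} → Parity m → ∀ j → dyadicᴳ (ℤ.suc m) (suc k) ≤ᴳ right (dyadicᴳ m (suc k)) j
  suc≤right′ (even a) = subst (λ X → ∀ j → dyadicᴳ (ℤ.suc (+ 2 ℤ.* a)) (suc k) ≤ᴳ right X j)
      (sym (dyadicᴳ-even a k))
    (λ j → ≤ᴳ-trans (subst (dyadicᴳ (ℤ.suc (+ 2 ℤ.* a)) (suc k) ≤ᴳ_) (dyadicᴳ-odd-suc a k)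
        (≤-suc′ (odd a))) (suc≤right a j))
  suc≤right′ (odd a) = subst (λ X → ∀ j → dyadicᴳ (ℤ.suc (1ℤ ℤ.+ + 2 ℤ.* a)) (suc k) ≤ᴳ right X j)
      (sym (dyadicᴳ-odd a k))
    (λ { zero → proj₁ (≃-reflexive (dyadicᴳ-odd-suc a k)) })

module _ (k : ℕ) where
  open Spaced (spaced k)

  dyadicᴳ-≤-+ : ∀ m n → dyadicᴳ m k ≤ᴳ dyadicᴳ (+ n ℤ.+ m) k
  dyadicᴳ-≤-+ m zero    = proj₁ (≃-reflexive (cong (λ m → dyadicᴳ m k) (sym (ℤ.+-identityˡ m))))
  dyadicᴳ-≤-+ m (suc n) = ≤ᴳ-trans (dyadicᴳ-≤-+ m n) (subst (dyadicᴳ (+ n ℤ.+ m) k ≤ᴳ_)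
    (cong (λ m → dyadicᴳ m k) (sym (ℤ.+-assoc 1ℤ (+ n) m))) (≤-suc (+ n ℤ.+ m)))

  dyadicᴳ-mono-≤ : ∀ {m n} → m ℤ.≤ n → dyadicᴳ m k ≤ᴳ dyadicᴳ n k
  dyadicᴳ-mono-≤ {m} {n} m≤n = subst (dyadicᴳ m k ≤ᴳ_) (cong (λ m → dyadicᴳ m k) eq)
    (dyadicᴳ-≤-+ m ℤ.∣ n ℤ.- m ∣)
    where
    lemma : ∀ m n → (n ℤ.- m) ℤ.+ m ≡ n
    lemma = solve-∀
    eq : + ℤ.∣ n ℤ.- m ∣ ℤ.+ m ≡ n
    eq = trans (cong (ℤ._+ m) (ℤ.0≤i⇒+∣i∣≡i (ℤ.i≤j⇒0≤j-i m≤n))) (lemma m n)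

  dyadicᴳ-mono-< : ∀ {m n} → m ℤ.< n → dyadicᴳ m k ⧏ dyadicᴳ n k
  dyadicᴳ-mono-< {m} m<n = ⧏-≤ᴳ-trans (⧏-suc m) (dyadicᴳ-mono-≤ (ℤ.i<j⇒suc[i]≤j m<n))

open AbelianGroup ⊕-abelianGroup using () renaming (∙-congʳ to ⊕-congʳ; ∙-congˡ to ⊕-congˡ)
open Algebra.Properties.AbelianGroup ⊕-abelianGroup using
    (⁻¹-∙-comm; ⁻¹-involutive; //-rightDividesˡ; //-rightDividesʳ; inverseˡ-unique)

naturalᴳ-suc : ∀ n → naturalᴳ n ⊕ naturalᴳ 1 ≃ naturalᴳ (suc n)
naturalᴳ-suc n = ≤-intro (left-⊕ (_⧏ naturalᴳ (suc n)) (naturalᴳ n) (naturalᴳ 1) (lefts n)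
    (λ { zero → viaLeft zero (proj₁ (⊕-identityʳ (naturalᴳ n))) })) (λ ()) ,
  ≤-intro (λ { zero → ⧏-⊕-leftʳ (naturalᴳ n) (naturalᴳ 1) zero (proj₂ (⊕-identityʳ (naturalᴳ n))) })
    (right-⊕ (naturalᴳ (suc n) ⧏_) (naturalᴳ n) (naturalᴳ 1) (rights n) (λ ()))
  where
  lefts : ∀ n i → left (naturalᴳ n) i ⊕ naturalᴳ 1 ⧏ naturalᴳ (suc n)
  lefts (suc n) zero = viaLeft zero (proj₁ (naturalᴳ-suc n))
  rights : ∀ n j → naturalᴳ (suc n) ⧏ right (naturalᴳ n) j ⊕ naturalᴳ 1
  rights zero ()
  rights (suc n) ()

integerᴳ-suc : ∀ m → integerᴳ m ⊕ naturalᴳ 1 ≃ integerᴳ (ℤ.suc m)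
integerᴳ-suc (+ n)    = naturalᴳ-suc n
integerᴳ-suc -[1+ n ] = ≃-trans (⊕-congʳ (≃-trans (⊖-cong (≃-sym (naturalᴳ-suc n)))
    (≃-sym (⁻¹-∙-comm (naturalᴳ n) (naturalᴳ 1)))))
  (≃-trans (//-rightDividesˡ (naturalᴳ 1) (⊖ naturalᴳ n)) (⊖-natural n))
  where
  ⊖-natural : ∀ n → ⊖ naturalᴳ n ≃ integerᴳ (ℤ.suc -[1+ n ])
  ⊖-natural zero    = ⊖0ᴳ
  ⊖-natural (suc n) = ≃-refl

integerᴳ-+-naturalᴳ : ∀ m n → integerᴳ m ⊕ naturalᴳ n ≃ integerᴳ (m ℤ.+ + n)
integerᴳ-+-naturalᴳ m zero = ≃-trans (⊕-identityʳ (integerᴳ m))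
    (≃-reflexive (cong integerᴳ (sym (ℤ.+-identityʳ m))))
integerᴳ-+-naturalᴳ m (suc n) =
  ≃-trans (⊕-congˡ {integerᴳ m} (≃-sym (naturalᴳ-suc n)))
  (≃-trans (≃-sym (⊕-assoc (integerᴳ m) (naturalᴳ n) (naturalᴳ 1)))
  (≃-trans (⊕-congʳ {naturalᴳ 1} (integerᴳ-+-naturalᴳ m n))
  (≃-trans (integerᴳ-suc (m ℤ.+ + n)) (≃-reflexive (cong integerᴳ (lemma m (+ n)))))))
  where
  lemma : ∀ m n → 1ℤ ℤ.+ (m ℤ.+ n) ≡ m ℤ.+ (1ℤ ℤ.+ n)
  lemma = solve-∀

integerᴳ-+ : ∀ m n → integerᴳ m ⊕ integerᴳ n ≃ integerᴳ (m ℤ.+ n)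
integerᴳ-+ m (+ n)    = integerᴳ-+-naturalᴳ m n
integerᴳ-+ m -[1+ n ] = ≃-trans (⊕-congʳ (≃-sym (≃-trans
    (integerᴳ-+-naturalᴳ (m ℤ.+ -[1+ n ]) (suc n))
    (≃-reflexive (cong integerᴳ (lemma m (+ suc n)))))))
  (//-rightDividesʳ (naturalᴳ (suc n)) (integerᴳ (m ℤ.+ -[1+ n ])))
  where
  lemma : ∀ m n → (m ℤ.- n) ℤ.+ n ≡ m
  lemma = solve-∀

≤ᴳ-resp-≡ : ∀ {X X′ Y Y′ Z Z′} → X ≡ X′ → Y ≡ Y′ → Z ≡ Z′ → X′ ⊕ Y′ ≤ᴳ Z′ → X ⊕ Y ≤ᴳ Z
≤ᴳ-resp-≡ refl refl refl p = p

dyadicᴳ-+-≤ : ∀ k m n → dyadicᴳ m k ⊕ dyadicᴳ n k ≤ᴳ dyadicᴳ (m ℤ.+ n) k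
dyadicᴳ-+-≤ zero    m n = proj₁ (integerᴳ-+ m n)
dyadicᴳ-+-≤ (suc k) m n = by-parity (parity m) (parity n)
  where
  open Spaced (spaced k)
  D = λ m → dyadicᴳ m k
  B = λ m → between m k

  +-≤ : ∀ a b {c} → a ℤ.+ b ≡ c → D a ⊕ D b ≤ᴳ D c
  +-≤ a b refl = dyadicᴳ-+-≤ k a b

  odd-even : ∀ a b → B a ⊕ D b ≤ᴳ B (a ℤ.+ b)
  odd-even a b = ≤-intro
    (left-⊕ (_⧏ B (a ℤ.+ b)) (B a) (D b)
      (λ { zero → viaLeft zero (+-≤ a b refl) })
      -- A move in the even summand loses at least a full step of level k, which makes up for
      -- rounding the odd summand up to its right option.
      (λ i → ≤ᴳ-⧏-trans (⊕-mono (≤-intro (λ { zero → ⧏-suc a })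
          (λ j → viaRight zero (suc-right j))) (left≤pred b i))
               (≤ᴳ-⧏-trans (+-≤ (ℤ.suc a) (ℤ.pred b) (lemma a b)) (left-⧏ (B (a ℤ.+ b)) zero))))
    (λ { zero → ⊕-⧏-rightˡ (B a) (D b) zero (+-≤ (ℤ.suc a) b (ℤ.+-assoc 1ℤ a b)) })
    where
    lemma : ∀ a b → (1ℤ ℤ.+ a) ℤ.+ (-1ℤ ℤ.+ b) ≡ a ℤ.+ b
    lemma = solve-∀
    suc-right : ∀ j → D (ℤ.suc a) ≤ᴳ right (D (ℤ.suc a)) j
    suc-right j = ≤ᴳ-trans (≤-suc (ℤ.suc a)) (suc≤right (ℤ.suc a) j)

  odd-odd : ∀ a b → B a ⊕ B b ≤ᴳ D (ℤ.suc (a ℤ.+ b))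
  odd-odd a b = ≤-intro
    (left-⊕ (_⧏ D (ℤ.suc (a ℤ.+ b))) (B a) (B b)
      (λ { zero → ⧏-≤ᴳ-trans (⊕-monoʳ-⧏ (D a) (⧏-right (B b) zero)) (+-≤ a (ℤ.suc b) (lemma₁ a b))
          })
      (λ { zero → ⧏-≤ᴳ-trans (⊕-monoˡ-⧏ (D b) (⧏-right (B a) zero))
          (+-≤ (ℤ.suc a) b (ℤ.+-assoc 1ℤ a b)) }))
    -- Every right option of the target lies at least a step above it, which leaves room to round
    -- both odd summands up, one of them strictly.
    (λ j → ⧏-≤ᴳ-trans (⧏-≤ᴳ-trans (⊕-monoˡ-⧏ (B b) (⧏-right (B a) zero))
             (≤ᴳ-trans (⊕-monoʳ (D (ℤ.suc a)) (≤-intro (λ { zero → ⧏-suc b })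
                 (λ j → viaRight zero (≤ᴳ-trans (≤-suc (ℤ.suc b)) (suc≤right (ℤ.suc b) j)))))
               (+-≤ (ℤ.suc a) (ℤ.suc b) (lemma₂ a b))))
             (suc≤right (ℤ.suc (a ℤ.+ b)) j))
    where
    lemma₁ : ∀ a b → a ℤ.+ (1ℤ ℤ.+ b) ≡ 1ℤ ℤ.+ (a ℤ.+ b)
    lemma₁ = solve-∀
    lemma₂ : ∀ a b → (1ℤ ℤ.+ a) ℤ.+ (1ℤ ℤ.+ b) ≡ 1ℤ ℤ.+ (1ℤ ℤ.+ (a ℤ.+ b))
    lemma₂ = solve-∀

  at-even : ∀ {m} a → m ≡ + 2 ℤ.* a → dyadicᴳ m (suc k) ≡ D a
  at-even a refl = dyadicᴳ-even a k

  at-odd : ∀ {m} a → m ≡ 1ℤ ℤ.+ + 2 ℤ.* a → dyadicᴳ m (suc k) ≡ B a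
  at-odd a refl = dyadicᴳ-odd a k

  by-parity : ∀ {m n} → Parity m → Parity n →
              dyadicᴳ m (suc k) ⊕ dyadicᴳ n (suc k) ≤ᴳ dyadicᴳ (m ℤ.+ n) (suc k)
  by-parity (even a) (even b) = ≤ᴳ-resp-≡ (dyadicᴳ-even a k) (dyadicᴳ-even b k)
      (at-even (a ℤ.+ b) (lemma a b)) (+-≤ a b refl)
    where
    lemma : ∀ a b → + 2 ℤ.* a ℤ.+ + 2 ℤ.* b ≡ + 2 ℤ.* (a ℤ.+ b)
    lemma = solve-∀
  by-parity (odd a)  (even b) = ≤ᴳ-resp-≡ (dyadicᴳ-odd a k) (dyadicᴳ-even b k)
      (at-odd (a ℤ.+ b) (lemma a b)) (odd-even a b)
    where
    lemma : ∀ a b → (1ℤ ℤ.+ + 2 ℤ.* a) ℤ.+ + 2 ℤ.* b ≡ 1ℤ ℤ.+ + 2 ℤ.* (a ℤ.+ b)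
    lemma = solve-∀
  by-parity (even a) (odd b)  = ≤ᴳ-resp-≡ (dyadicᴳ-even a k) (dyadicᴳ-odd b k)
      (at-odd (b ℤ.+ a) (lemma a b))
    (≤ᴳ-trans (⊕-comm-≤ (D a) (B b)) (odd-even b a))
    where
    lemma : ∀ a b → + 2 ℤ.* a ℤ.+ (1ℤ ℤ.+ + 2 ℤ.* b) ≡ 1ℤ ℤ.+ + 2 ℤ.* (b ℤ.+ a)
    lemma = solve-∀
  by-parity (odd a)  (odd b)  = ≤ᴳ-resp-≡ (dyadicᴳ-odd a k) (dyadicᴳ-odd b k)
      (at-even (ℤ.suc (a ℤ.+ b)) (lemma a b)) (odd-odd a b)
    where
    lemma : ∀ a b → (1ℤ ℤ.+ + 2 ℤ.* a) ℤ.+ (1ℤ ℤ.+ + 2 ℤ.* b) ≡ + 2 ℤ.* (1ℤ ℤ.+ (a ℤ.+ b))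
    lemma = solve-∀

⊖-dyadicᴳ-≤ : ∀ k m → ⊖ dyadicᴳ m k ≤ᴳ dyadicᴳ (ℤ.- m) k
⊖-dyadicᴳ-≤ zero (+ zero)  = proj₁ ⊖0ᴳ
⊖-dyadicᴳ-≤ zero (+ suc n) = ≤ᴳ-refl
⊖-dyadicᴳ-≤ zero -[1+ n ]  = proj₁ (⁻¹-involutive (naturalᴳ (suc n)))
⊖-dyadicᴳ-≤ (suc k) m      = by-parity (parity m)
  where
  by-parity : ∀ {m} → Parity m → ⊖ dyadicᴳ m (suc k) ≤ᴳ dyadicᴳ (ℤ.- m) (suc k)
  by-parity (even a) = subst₂ (λ X Y → ⊖ X ≤ᴳ Y) (sym (dyadicᴳ-even a k))
    (sym (trans (cong (λ m → dyadicᴳ m (suc k)) (lemma a)) (dyadicᴳ-even (ℤ.- a) k)))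
    (⊖-dyadicᴳ-≤ k a)
    where
    lemma : ∀ a → ℤ.- (+ 2 ℤ.* a) ≡ + 2 ℤ.* (ℤ.- a)
    lemma = solve-∀
  by-parity (odd a) = subst₂ (λ X Y → ⊖ X ≤ᴳ Y) (sym (dyadicᴳ-odd a k))
    (sym (trans (cong (λ m → dyadicᴳ m (suc k)) (lemma a)) (dyadicᴳ-odd (ℤ.- (ℤ.suc a)) k)))
    (≤-intro (λ { zero → viaLeft zero (⊖-dyadicᴳ-≤ k (ℤ.suc a)) })
             (λ { zero → viaRight zero (subst (λ b → ⊖ dyadicᴳ a k ≤ᴳ dyadicᴳ b k) (lemma′ a)
                 (⊖-dyadicᴳ-≤ k a)) }))
    where
    lemma : ∀ a → ℤ.- (1ℤ ℤ.+ + 2 ℤ.* a) ≡ 1ℤ ℤ.+ + 2 ℤ.* (ℤ.- (1ℤ ℤ.+ a))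
    lemma = solve-∀
    lemma′ : ∀ a → ℤ.- a ≡ 1ℤ ℤ.+ ℤ.- (1ℤ ℤ.+ a)
    lemma′ = solve-∀

-- The reverse inequality follows from the first one for m + n and - n.
dyadicᴳ-+ : ∀ k m n → dyadicᴳ m k ⊕ dyadicᴳ n k ≃ dyadicᴳ (m ℤ.+ n) k
dyadicᴳ-+ k m n = dyadicᴳ-+-≤ k m n ,
  ≤ᴳ-trans (proj₂ (//-rightDividesˡ (D n) (D (m ℤ.+ n))))
  (⊕-monoˡ (D n) (≤ᴳ-trans (⊕-monoʳ (D (m ℤ.+ n)) (⊖-dyadicᴳ-≤ k n))
  (subst (λ c → D (m ℤ.+ n) ⊕ D (ℤ.- n) ≤ᴳ D c) (lemma m n) (dyadicᴳ-+-≤ k (m ℤ.+ n) (ℤ.- n)))))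
  where
  D = λ m → dyadicᴳ m k
  lemma : ∀ m n → (m ℤ.+ n) ℤ.- n ≡ m
  lemma = solve-∀

dyadicᴳ-scale : ∀ j m k → dyadicᴳ (+ (2 ^ j) ℤ.* m) (j ℕ.+ k) ≡ dyadicᴳ m k
dyadicᴳ-scale zero    m k = cong (λ m → dyadicᴳ m k) (ℤ.*-identityˡ m)
dyadicᴳ-scale (suc j) m k = trans
  (cong (λ m → dyadicᴳ m (suc (j ℕ.+ k))) (trans (cong (ℤ._* m) (ℤ.pos-* 2 (2 ^ j)))
      (ℤ.*-assoc (+ 2) (+ (2 ^ j)) m)))
  (trans (dyadicᴳ-even (+ (2 ^ j) ℤ.* m) (j ℕ.+ k)) (dyadicᴳ-scale j m k))

dyadicᴳ-unique : ∀ {m n} k l → m ℤ.* + (2 ^ l) ≡ n ℤ.* + (2 ^ k) → dyadicᴳ m k ≡ dyadicᴳ n l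
dyadicᴳ-unique {m} {n} k l eq =
  trans (sym (dyadicᴳ-scale l m k))
  (trans (cong₂ dyadicᴳ (trans (ℤ.*-comm _ m) (trans eq (ℤ.*-comm n _))) (ℕ.+-comm l k))
  (dyadicᴳ-scale k n l))

-- Canonical forms over a common denominator

exponent : ℤ[½] → ℕ
exponent x = ⌊log₂ ↧ₙ value x ⌋

-- The proof of dyadicity is irrelevant, so the exponent in it cannot be returned. The logarithm
-- names it instead, and the resulting equation is decidable, hence recomputable.
↧≡2^exponent : ∀ x → ↧ value x ≡ + (2 ^ exponent x)
↧≡2^exponent (q , [ d ]) = cong +_ (recompute (↧ₙ q ℕ.≟ 2 ^ ⌊log₂ ↧ₙ q ⌋) (lemma d))
  where
  lemma : IsDyadic q → ↧ₙ q ≡ 2 ^ ⌊log₂ ↧ₙ q ⌋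
  lemma (k , eq) = trans eq (cong (2 ^_) (sym (trans (cong ⌊log₂_⌋ eq) (⌊log₂[2^n]⌋≡n k))))

numberᴳ≡dyadicᴳ : ∀ x {m} k → ↥ value x ℤ.* + (2 ^ k) ≡ m ℤ.* ↧ value x → numberᴳ x ≡ dyadicᴳ m k
numberᴳ≡dyadicᴳ x {m} k eq = dyadicᴳ-unique (exponent x) k
    (trans eq (cong (m ℤ.*_) (↧≡2^exponent x)))

-- Over the product of the denominators, the numerators are the very cross products by which order
-- and sum on ℚ are defined. Facts about rationals thus become facts about integer numerators at one
-- level k.
module CommonDenominator (x y : ℤ[½]) where
  k = exponent x ℕ.+ exponent y

  2^k : + (2 ^ k) ≡ ↧ value x ℤ.* ↧ value y
  2^k = trans (cong +_ (ℕ.^-distribˡ-+-* 2 (exponent x) (exponent y)))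
        (trans (ℤ.pos-* (2 ^ exponent x) (2 ^ exponent y))
               (sym (cong₂ ℤ._*_ (↧≡2^exponent x) (↧≡2^exponent y))))

  numberᴳ-x : numberᴳ x ≡ dyadicᴳ (↥ value x ℤ.* ↧ value y) k
  numberᴳ-x = numberᴳ≡dyadicᴳ x k (trans (cong (↥ value x ℤ.*_) 2^k)
      (lemma (↥ value x) (↧ value x) (↧ value y)))
    where
    lemma : ∀ p q r → p ℤ.* (q ℤ.* r) ≡ p ℤ.* r ℤ.* q
    lemma = solve-∀

  numberᴳ-y : numberᴳ y ≡ dyadicᴳ (↥ value y ℤ.* ↧ value x) k
  numberᴳ-y = numberᴳ≡dyadicᴳ y k (trans (cong (↥ value y ℤ.*_) 2^k)
      (lemma (↥ value y) (↧ value x) (↧ value y)))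
    where
    lemma : ∀ p q r → p ℤ.* (q ℤ.* r) ≡ p ℤ.* q ℤ.* r
    lemma = solve-∀

  numberᴳ-x+y : numberᴳ (x + y) ≡ dyadicᴳ (↥ value x ℤ.* ↧ value y ℤ.+ ↥ value y ℤ.* ↧ value x) k
  numberᴳ-x+y = numberᴳ≡dyadicᴳ (x + y) k (trans (cong (↥ value (x + y) ℤ.*_) 2^k)
      (eq (value x) (value y) _ (ℚ.toℚᵘ-homo-+ (value x) (value y))))
    where
    eq : ∀ p q r → ℚ.toℚᵘ r ℚᵘ.≃ ℚ.toℚᵘ p ℚᵘ.+ ℚ.toℚᵘ q →
         ↥ r ℤ.* (↧ p ℤ.* ↧ q) ≡ (↥ p ℤ.* ↧ q ℤ.+ ↥ q ℤ.* ↧ p) ℤ.* ↧ r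
    -- Matching on the records lets `toℚᵘ` compute; the equation of unnormalised fractions is then
    -- the goal itself.
    eq record{} record{} record{} (ℚᵘ.*≡* e) = e

  numberᴳ-mono-≤ : x ≤ y → numberᴳ x ≤ᴳ numberᴳ y
  numberᴳ-mono-≤ x≤y = subst₂ _≤ᴳ_ (sym numberᴳ-x) (sym numberᴳ-y)
      (dyadicᴳ-mono-≤ k (ℚ.drop-*≤* x≤y))

  numberᴳ-mono-< : x < y → numberᴳ x ⧏ numberᴳ y
  numberᴳ-mono-< x<y = subst₂ _⧏_ (sym numberᴳ-x) (sym numberᴳ-y)
      (dyadicᴳ-mono-< k (ℚ.drop-*<* x<y))

  numberᴳ-+ : numberᴳ x ⊕ numberᴳ y ≃ numberᴳ (x + y)
  numberᴳ-+ = subst₂ _≃_ (sym (cong₂ _⊕_ numberᴳ-x numberᴳ-y)) (sym numberᴳ-x+y)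
    (dyadicᴳ-+ k (↥ value x ℤ.* ↧ value y) (↥ value y ℤ.* ↧ value x))

open CommonDenominator using (numberᴳ-mono-≤; numberᴳ-mono-<; numberᴳ-+)

-- Arithmetic of dyadic rationals

module Max = Algebra.Construct.NaturalChoice.Max (DecTotalOrder.totalOrder ≤-decTotalOrder)
module Min = Algebra.Construct.NaturalChoice.Min (DecTotalOrder.totalOrder ≤-decTotalOrder)

value-injective : ∀ {x y : ℤ[½]} → value x ≡ value y → x ≡ y
value-injective {_ , [ _ ]} {_ , [ _ ]} refl = refl

-- In x ≤ y and x < y the proofs of dyadicity disappear by unfolding, so that x
-- and y cannot be inferred; the wrappers prevent the unfolding.
infix 4 _≤ᴰ_ _<ᴰ_

record _≤ᴰ_ (x y : ℤ[½]) : Set where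
  constructor wrap≤
  field unwrap≤ : x ≤ y
open _≤ᴰ_

record _<ᴰ_ (x y : ℤ[½]) : Set where
  constructor wrap<
  field unwrap< : x < y
open _<ᴰ_

≤-refl : ∀ {x} → x ≤ᴰ x
≤-refl = wrap≤ ℚ.≤-refl

≤-reflexive : ∀ {x y} → x ≡ y → x ≤ᴰ y
≤-reflexive refl = ≤-refl

≤-trans : ∀ {x y z} → x ≤ᴰ y → y ≤ᴰ z → x ≤ᴰ z
≤-trans (wrap≤ p) (wrap≤ q) = wrap≤ (ℚ.≤-trans p q)

≤-antisym : ∀ {x y} → x ≤ᴰ y → y ≤ᴰ x → x ≡ y
≤-antisym (wrap≤ p) (wrap≤ q) = value-injective (ℚ.≤-antisym p q)

≤⊎> : ∀ x y → x ≤ᴰ y ⊎ y <ᴰ x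
≤⊎> x y with x ≤? y
... | yes x≤y = inj₁ (wrap≤ x≤y)
... | no  x≰y = inj₂ (wrap< (ℚ.≰⇒> x≰y))

<⇒≤ : ∀ {x y} → x <ᴰ y → x ≤ᴰ y
<⇒≤ (wrap< p) = wrap≤ (ℚ.<⇒≤ p)

≤-total : ∀ x y → x ≤ᴰ y ⊎ y ≤ᴰ x
≤-total x y = Sum.map₂ <⇒≤ (≤⊎> x y)

<⇒≱ : ∀ {x y} → x <ᴰ y → ¬ y ≤ᴰ x
<⇒≱ (wrap< p) (wrap≤ q) = ℚ.<-irrefl refl (ℚ.<-≤-trans p q)

≰⇒> : ∀ {x y} → ¬ x ≤ᴰ y → y <ᴰ x
≰⇒> {x} {y} x≰y with ≤⊎> x y
... | inj₁ x≤y = contradiction x≤y x≰y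
... | inj₂ y<x = y<x

≮⇒≥ : ∀ {x y} → ¬ x <ᴰ y → y ≤ᴰ x
≮⇒≥ {x} {y} x≮y with ≤⊎> y x
... | inj₁ y≤x = y≤x
... | inj₂ x<y = contradiction x<y x≮y

<-≤-trans : ∀ {x y z} → x <ᴰ y → y ≤ᴰ z → x <ᴰ z
<-≤-trans (wrap< p) (wrap≤ q) = wrap< (ℚ.<-≤-trans p q)

≤-<-trans : ∀ {x y z} → x ≤ᴰ y → y <ᴰ z → x <ᴰ z
≤-<-trans (wrap≤ p) (wrap< q) = wrap< (ℚ.≤-<-trans p q)

+-abelianGroup : AbelianGroup 0ℓ 0ℓ
+-abelianGroup = record
  { Carrier = ℤ[½] ; _≈_ = _≡_ ; _∙_ = _+_ ; ε = integer 0ℤ ; _⁻¹ = λ x → - x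
  ; isAbelianGroup = record
    { isGroup = record
      { isMonoid = record
        { isSemigroup = record
          { isMagma = record { isEquivalence = isEquivalence ; ∙-cong = cong₂ _+_ }
          ; assoc = λ x y z → value-injective (ℚ.+-assoc (value x) (value y) (value z)) }
        ; identity = (λ x → value-injective (ℚ.+-identityˡ (value x))) ,
                     (λ x → value-injective (ℚ.+-identityʳ (value x))) }
      ; inverse = (λ x → value-injective (ℚ.+-inverseˡ (value x))) ,
                  (λ x → value-injective (ℚ.+-inverseʳ (value x)))
      ; ⁻¹-cong = cong (λ x → - x) }
    ; comm = λ x y → value-injective (ℚ.+-comm (value x) (value y)) } }

open AbelianGroup +-abelianGroup using ()
  renaming (assoc to +-assoc; comm to +-comm; identityˡ to +-identityˡ; identityʳ to +-identityʳ;
      inverseˡ to +-inverseˡ; inverseʳ to +-inverseʳ)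
open Algebra.Properties.AbelianGroup +-abelianGroup using ()
  renaming (⁻¹-∙-comm to neg-distrib-+; ⁻¹-involutive to neg-involutive;
            inverseˡ-unique to +≡0⇒≡-neg; //-rightDividesˡ to m-n+n≡m; //-rightDividesʳ to m+n-n≡m)

+-mono-≤ : ∀ {x y z w} → x ≤ᴰ y → z ≤ᴰ w → x + z ≤ᴰ y + w
+-mono-≤ (wrap≤ p) (wrap≤ q) = wrap≤ (ℚ.+-mono-≤ p q)

+-monoˡ-≤ : ∀ {x y} z → x ≤ᴰ y → x + z ≤ᴰ y + z
+-monoˡ-≤ z x≤y = +-mono-≤ x≤y (≤-refl {z})

+-monoʳ-≤ : ∀ {x y} z → x ≤ᴰ y → z + x ≤ᴰ z + y
+-monoʳ-≤ z x≤y = +-mono-≤ (≤-refl {z}) x≤y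

+-monoˡ-< : ∀ {x y} z → x <ᴰ y → x + z <ᴰ y + z
+-monoˡ-< z (wrap< p) = wrap< (ℚ.+-monoˡ-< (value z) p)

+-monoʳ-< : ∀ {x y} z → x <ᴰ y → z + x <ᴰ z + y
+-monoʳ-< z (wrap< p) = wrap< (ℚ.+-monoʳ-< (value z) p)

neg-anti-≤ : ∀ {x y} → x ≤ᴰ y → - y ≤ᴰ - x
neg-anti-≤ (wrap≤ p) = wrap≤ (ℚ.neg-antimono-≤ p)

≤+⇒-≤ : ∀ {x} y z → x ≤ᴰ y + z → x - z ≤ᴰ y
≤+⇒-≤ {x} y z x≤y+z = subst (x - z ≤ᴰ_) (m+n-n≡m z y) (+-monoˡ-≤ (- z) x≤y+z)

<+⇒-< : ∀ {x} y z → x <ᴰ y + z → x - z <ᴰ y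
<+⇒-< {x} y z x<y+z = subst (x - z <ᴰ_) (m+n-n≡m z y) (+-monoˡ-< (- z) x<y+z)

+<⇒<- : ∀ x {y} z → x + z <ᴰ y → x <ᴰ y - z
+<⇒<- x {y} z x+z<y = subst (_<ᴰ y - z) (m+n-n≡m z x) (+-monoˡ-< (- z) x+z<y)

+-cancelʳ-≤ : ∀ x y z → x + z ≤ᴰ y + z → x ≤ᴰ y
+-cancelʳ-≤ x y z p = subst (_≤ᴰ y) (m+n-n≡m z x) (≤+⇒-≤ y z p)

+-cancelʳ-< : ∀ x y z → x + z <ᴰ y + z → x <ᴰ y
+-cancelʳ-< x y z p = subst (_<ᴰ y) (m+n-n≡m z x) (<+⇒-< y z p)

neg-+-cancel : ∀ x y → - (x + y) + y ≡ - x
neg-+-cancel x y = trans (cong (_+ y) (sym (neg-distrib-+ x y))) (m-n+n≡m y (- x))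

half : ℤ[½] → ℤ[½]
half x = x * (ℚ.½ , [ (1 , refl) ])

half+half : ∀ x → half x + half x ≡ x
half+half x = value-injective (trans (sym (ℚ.*-distribˡ-+ (value x) ℚ.½ ℚ.½))
    (ℚ.*-identityʳ (value x)))

≤-from-double : ∀ x y → x + x ≤ᴰ y + y → x ≤ᴰ y
≤-from-double x y p with ≤⊎> x y
... | inj₁ x≤y = x≤y
... | inj₂ y<x = contradiction p (<⇒≱ (<-≤-trans (+-monoˡ-< y y<x) (<⇒≤ (+-monoʳ-< x y<x))))

<-dense : ∀ {x y} → x <ᴰ y → ∃[ z ] x <ᴰ z × z <ᴰ y
<-dense {x} {y} x<y = h ,
  ≰⇒> (λ h≤x → <⇒≱ (+-monoʳ-< x x<y) (subst (_≤ᴰ x + x) (half+half (x + y)) (+-mono-≤ h≤x h≤x))) ,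
  ≰⇒> (λ y≤h → <⇒≱ (+-monoˡ-< y x<y) (subst (y + y ≤ᴰ_) (half+half (x + y)) (+-mono-≤ y≤h y≤h)))
  where h = half (x + y)

<-suc : ∀ x → x <ᴰ x + integer 1ℤ
<-suc x = subst (_<ᴰ x + integer 1ℤ) (+-identityʳ x) (+-monoʳ-< x
    (wrap< {integer 0ℤ} {integer 1ℤ} (ℚ.*<* (ℤ.+<+ (ℕ.s≤s ℕ.z≤n)))))

pred-< : ∀ x → x - integer 1ℤ <ᴰ x
pred-< x = <+⇒-< x (integer 1ℤ) (<-suc x)

≤max : ∀ {n} (v : Vector ℤ[½] (suc n)) i → v i ≤ᴰ max v
≤max {zero}  v zero    = ≤-refl
≤max {suc n} v zero    = wrap≤ (Max.x≤x⊔y (v zero) (max (v ∘ suc)))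
≤max {suc n} v (suc i) = ≤-trans (≤max (v ∘ suc) i) (wrap≤ (Max.x≤y⊔x (v zero) (max (v ∘ suc))))

min≤ : ∀ {n} (v : Vector ℤ[½] (suc n)) i → min v ≤ᴰ v i
min≤ {zero}  v zero    = ≤-refl
min≤ {suc n} v zero    = wrap≤ (Min.x⊓y≤x (v zero) (min (v ∘ suc)))
min≤ {suc n} v (suc i) = ≤-trans (wrap≤ (Min.x⊓y≤y (v zero) (min (v ∘ suc)))) (min≤ (v ∘ suc) i)

max-sel : ∀ {n} (v : Vector ℤ[½] (suc n)) → ∃[ i ] max v ≡ v i
max-sel {zero}  v = zero , refl
max-sel {suc n} v with Max.⊔-sel (v zero) (max (v ∘ suc)) | max-sel (v ∘ suc)
... | inj₁ eq | _       = zero , value-injective eq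
... | inj₂ eq | i , eq′ = suc i , trans (value-injective eq) eq′

min-sel : ∀ {n} (v : Vector ℤ[½] (suc n)) → ∃[ i ] min v ≡ v i
min-sel {zero}  v = zero , refl
min-sel {suc n} v with Min.⊓-sel (v zero) (min (v ∘ suc)) | min-sel (v ∘ suc)
... | inj₁ eq | _       = zero , value-injective eq
... | inj₂ eq | i , eq′ = suc i , trans (value-injective eq) eq′

max-lub : ∀ {n} (v : Vector ℤ[½] (suc n)) {x} → (∀ i → v i ≤ᴰ x) → max v ≤ᴰ x
max-lub v {x} v≤x = let i , eq = max-sel v in subst (_≤ᴰ x) (sym eq) (v≤x i)

min-glb : ∀ {n} (v : Vector ℤ[½] (suc n)) {x} → (∀ i → x ≤ᴰ v i) → x ≤ᴰ min v
min-glb v {x} x≤v = let i , eq = min-sel v in subst (x ≤ᴰ_) (sym eq) (x≤v i)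

max-cong : ∀ {n} {v w : Vector ℤ[½] (suc n)} → (∀ i → v i ≡ w i) → max v ≡ max w
max-cong {zero}  eq = eq zero
max-cong {suc n} eq = cong₂ _⊔_ (eq zero) (max-cong (eq ∘ suc))

neg-min : ∀ {n} (v : Vector ℤ[½] (suc n)) → - min v ≡ max (λ i → - v i)
neg-min v = ≤-antisym
  (let i , eq = min-sel v in subst (_≤ᴰ max (λ i → - v i)) (cong (λ x → - x) (sym eq))
           (≤max (λ i → - v i) i))
  (max-lub (λ i → - v i) (λ i → neg-anti-≤ (min≤ v i)))

∃-below : ∀ {n} (v : Vector ℤ[½] n) → ∃[ x ] (∀ i → x <ᴰ v i)
∃-below {zero}  v = integer 0ℤ , λ ()
∃-below {suc n} v = min v - integer 1ℤ , λ i → <-≤-trans (pred-< (min v)) (min≤ v i)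

∃-above : ∀ {n} (v : Vector ℤ[½] n) → ∃[ x ] (∀ i → v i <ᴰ x)
∃-above {zero}  v = integer 0ℤ , λ ()
∃-above {suc n} v = max v + integer 1ℤ , λ i → ≤-<-trans (≤max v i) (<-suc (max v))

-- Simplicity and stops

-- What the descent in `simplicity` requires of a form: every position satisfies P and lies weakly
-- between its left and its right options. Canonical forms of integers and of dyadics have this
-- shape, with P being equality to an integer or to a number.
data Hereditarily (P : Game → Set) (G : Game) : Set where
  node : P G → (∀ i → left G i ≤ᴳ G × Hereditarily P (left G i)) →
               (∀ j → G ≤ᴳ right G j × Hereditarily P (right G j)) → Hereditarily P G

Fits : Game → Game → Set
Fits X G = (∀ i → left G i ⧏ X) × (∀ j → X ⧏ right G j)

-- If G and a fitting X differ, the fit forces the winning move to be one in X. The option of X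
-- reached has moved towards G, so it still fits. The descent ends at a position of X that equals G.
simplicity : ∀ {P X G} → Hereditarily P X → Fits X G → ∃[ Y ] P Y × G ≃ Y
simplicity {P} {X} {G} (node p lefts rights) (GL⧏X , X⧏GR) with ≤ᴳ⊎⧏ G X | ≤ᴳ⊎⧏ X G
... | inj₁ G≤X | inj₁ X≤G = X , p , G≤X , X≤G
... | inj₂ (viaLeft i X≤GL) | _ = contradiction (GL⧏X i) (≤ᴳ⇒¬⧏ X≤GL)
... | inj₂ (viaRight j XR≤G) | _ = let X≤XR , h = rights j in
  simplicity h ((λ i → ⧏-≤ᴳ-trans (GL⧏X i) X≤XR) , (λ j → ≤ᴳ-⧏-trans XR≤G (⧏-right G j)))
... | inj₁ _ | inj₂ (viaLeft i G≤XL) = let XL≤X , h = lefts i in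
  simplicity h ((λ i → ⧏-≤ᴳ-trans (left-⧏ G i) G≤XL) , (λ j → ≤ᴳ-⧏-trans XL≤X (X⧏GR j)))
... | inj₁ _ | inj₂ (viaRight j GR≤X) = contradiction (X⧏GR j) (≤ᴳ⇒¬⧏ GR≤X)

hereditarily-map : ∀ {P Q : Game → Set} → (∀ {G} → P G → Q G) → ∀ {G} → Hereditarily P G →
    Hereditarily Q G
hereditarily-map f (node p lefts rights) = node (f p)
  (λ i → proj₁ (lefts i) , hereditarily-map f (proj₂ (lefts i)))
  (λ j → proj₁ (rights j) , hereditarily-map f (proj₂ (rights j)))

hereditarily-naturalᴳ : ∀ n → Hereditarily EqualToInteger (naturalᴳ n)
hereditarily-naturalᴳ zero    = node (0ℤ , ≃⇒≈ {0ᴳ} {0ᴳ} ≃-refl) (λ ()) (λ ())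
hereditarily-naturalᴳ (suc n) = node (+ suc n , ≃⇒≈ {naturalᴳ (suc n)} {naturalᴳ (suc n)} ≃-refl)
  (λ { zero → naturalᴳ-≤-suc n , hereditarily-naturalᴳ n }) (λ ())

hereditarily-⊖naturalᴳ : ∀ n → Hereditarily EqualToInteger (⊖ naturalᴳ n)
hereditarily-⊖naturalᴳ zero    = node (0ℤ , ≃⇒≈ {⊖ 0ᴳ} {0ᴳ} ⊖0ᴳ) (λ ()) (λ ())
hereditarily-⊖naturalᴳ (suc n) = node (-[1+ n ] , ≃⇒≈ {⊖ naturalᴳ (suc n)} {⊖ naturalᴳ (suc n)}
    ≃-refl)
  (λ ()) (λ { zero → ⊖-anti (naturalᴳ-≤-suc n) , hereditarily-⊖naturalᴳ n })

hereditarily-integerᴳ : ∀ n → Hereditarily EqualToInteger (integerᴳ n)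
hereditarily-integerᴳ (+ n)    = hereditarily-naturalᴳ n
hereditarily-integerᴳ -[1+ n ] = hereditarily-⊖naturalᴳ (suc n)

≈-trans : ∀ {G H K} → G ≈ H → H ≈ K → G ≈ K
≈-trans {G} {H} {K} p q = ≃⇒≈ {G} {K} (≃-trans (≈⇒≃ {G} {H} p) (≈⇒≃ {H} {K} q))

-- The positions of an integer's canonical form are integers, so the descent never leaves them; the
-- integer found may differ from n.
fits⇒integer : ∀ {G} n → Fits (integerᴳ n) G → EqualToInteger G
fits⇒integer {G} n fits =
  let Y , (k , Y≈k) , G≃Y = simplicity (hereditarily-integerᴳ n) fits
  in k , ≈-trans {G} {Y} {integerᴳ k} (≃⇒≈ {G} {Y} G≃Y) Y≈k

2^k≢0 : ∀ k → ℕ.NonZero (2 ^ k)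
2^k≢0 k = ℕ.m^n≢0 2 k

dyadicᴳ-isNumber : ∀ m k → ∃[ x ] dyadicᴳ m k ≡ numberᴳ x
dyadicᴳ-isNumber m k = x , sym (numberᴳ≡dyadicᴳ x k (eq (↥ q) (↧ q) (gcd m (+ (2 ^ k)))
    (ℚ.↥-/ m (2 ^ k)) (ℚ.↧-/ m (2 ^ k))))
  where
  instance _ = 2^k≢0 k
  q = m ℚ./ 2 ^ k
  isDyadic : IsDyadic q
  isDyadic = ∣2^k⇒≡2^j k (divides ℤ.∣ gcd m (+ (2 ^ k)) ∣
    (trans (cong ℤ.∣_∣ (sym (ℚ.↧-/ m (2 ^ k)))) (trans (ℤ.abs-* (↧ q) (gcd m (+ (2 ^ k))))
        (ℕ.*-comm (↧ₙ q) _))))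
  x : ℤ[½]
  x = q , [ isDyadic ]
  lemma : ∀ p d g → p ℤ.* (d ℤ.* g) ≡ p ℤ.* g ℤ.* d
  lemma = solve-∀
  eq : ∀ p d g → p ℤ.* g ≡ m → d ℤ.* g ≡ + (2 ^ k) → p ℤ.* + (2 ^ k) ≡ m ℤ.* d
  eq p d g pg dg = trans (cong (p ℤ.*_) (sym dg)) (trans (lemma p d g) (cong (ℤ._* d) pg))

≡⇒equalToNumber : ∀ {G} m k → G ≡ dyadicᴳ m k → EqualToNumber G
≡⇒equalToNumber {G} m k eq = let x , eq′ = dyadicᴳ-isNumber m k in
  x , ≃⇒≈ {G} {numberᴳ x} (≃-reflexive (trans eq eq′))

hereditarily-dyadicᴳ : ∀ k m → Hereditarily EqualToNumber (dyadicᴳ m k)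
hereditarily-dyadicᴳ zero m = hereditarily-map
  (λ {G} (n , G≈n) → let x , eq = dyadicᴳ-isNumber n 0 in x , subst (G ≈_) eq G≈n)
                             (hereditarily-integerᴳ m)
hereditarily-dyadicᴳ (suc k) m = by-parity (parity m)
  where
  open Spaced (spaced (suc k))
  by-parity : ∀ {m} → Parity m → Hereditarily EqualToNumber (dyadicᴳ m (suc k))
  by-parity (even a) = subst (Hereditarily EqualToNumber) (sym (dyadicᴳ-even a k))
      (hereditarily-dyadicᴳ k a)
  by-parity (odd a)  = subst (Hereditarily EqualToNumber) (sym (dyadicᴳ-odd a k))
    (node (≡⇒equalToNumber (1ℤ ℤ.+ + 2 ℤ.* a) (suc k) (sym (dyadicᴳ-odd a k)))
      (λ { zero → subst₂ _≤ᴳ_ (dyadicᴳ-even a k) (dyadicᴳ-odd a k) (≤-suc (+ 2 ℤ.* a)) ,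
          hereditarily-dyadicᴳ k a })
      (λ { zero → subst₂ _≤ᴳ_ (dyadicᴳ-odd a k) (dyadicᴳ-odd-suc a k) (≤-suc (1ℤ ℤ.+ + 2 ℤ.* a)) ,
          hereditarily-dyadicᴳ k (ℤ.suc a) }))

hereditarily-numberᴳ : ∀ x → Hereditarily EqualToNumber (numberᴳ x)
hereditarily-numberᴳ x = hereditarily-dyadicᴳ (exponent x) (↥ value x)

fits⇒number : ∀ {G} x → Fits (numberᴳ x) G → EqualToNumber G
fits⇒number {G} x fits =
  let Y , (y , Y≈y) , G≃Y = simplicity (hereditarily-numberᴳ x) fits
  in y , ≈-trans {G} {Y} {numberᴳ y} (≃⇒≈ {G} {Y} G≃Y) Y≈y

numberᴳ-≤ : ∀ {x y} → x ≤ᴰ y → numberᴳ x ≤ᴳ numberᴳ y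
numberᴳ-≤ {x} {y} (wrap≤ p) = numberᴳ-mono-≤ x y p

numberᴳ-< : ∀ {x y} → x <ᴰ y → numberᴳ x ⧏ numberᴳ y
numberᴳ-< {x} {y} (wrap< p) = numberᴳ-mono-< x y p

numberᴳ-≤-right : ∀ x j → numberᴳ x ≤ᴳ right (numberᴳ x) j
numberᴳ-≤-right x j with hereditarily-numberᴳ x
... | node _ _ rights = proj₁ (rights j)

left-≤-numberᴳ : ∀ x i → left (numberᴳ x) i ≤ᴳ numberᴳ x
left-≤-numberᴳ x i with hereditarily-numberᴳ x
... | node _ lefts _ = proj₁ (lefts i)

⊖-numberᴳ : ∀ x → ⊖ numberᴳ x ≃ numberᴳ (- x)
⊖-numberᴳ x = ≃-sym (inverseˡ-unique (numberᴳ (- x)) (numberᴳ x)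
  (≃-trans (numberᴳ-+ (- x) x) (≃-reflexive (cong numberᴳ (+-inverseˡ x)))))

-- The left stop is the infimum of the numbers ≥ G and the right stop the
-- supremum of the numbers ≤ G.  These characterisations are invariant under
-- equality of values and compatible with translation by a number.
record IsLeftStop (G : Game) (l : ℤ[½]) : Set where
  field
    below : ∀ {y} → y <ᴰ l → numberᴳ y ⧏ G
    above : ∀ {y} → l <ᴰ y → G ≤ᴳ numberᴳ y

record IsRightStop (G : Game) (r : ℤ[½]) : Set where
  field
    below : ∀ {y} → y <ᴰ r → numberᴳ y ≤ᴳ G
    above : ∀ {y} → r <ᴰ y → G ⧏ numberᴳ y


leftStop-unique : ∀ {G l l′} → IsLeftStop G l → IsLeftStop G l′ → l ≡ l′
leftStop-unique {G} s s′ = ≤-antisym (≤-stop s′ s) (≤-stop s s′)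
  where
  ≤-stop : ∀ {l l′} → IsLeftStop G l → IsLeftStop G l′ → l′ ≤ᴰ l
  ≤-stop s s′ = ≮⇒≥ λ l<l′ → let y , l<y , y<l′ = <-dense l<l′ in ≤ᴳ⇒¬⧏ (IsLeftStop.above s l<y)
                                     (IsLeftStop.below s′ y<l′)

rightStop-unique : ∀ {G r r′} → IsRightStop G r → IsRightStop G r′ → r ≡ r′
rightStop-unique {G} s s′ = ≤-antisym (≤-stop s′ s) (≤-stop s s′)
  where
  ≤-stop : ∀ {r r′} → IsRightStop G r → IsRightStop G r′ → r′ ≤ᴰ r
  ≤-stop s s′ = ≮⇒≥ λ r<r′ → let y , r<y , y<r′ = <-dense r<r′ in ≤ᴳ⇒¬⧏
                                     (IsRightStop.below s′ y<r′) (IsRightStop.above s r<y)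

number-leftStop : ∀ {G} x → G ≃ numberᴳ x → IsLeftStop G x
number-leftStop x (G≤x , x≤G) = record
  { below = λ y<x → ⧏-≤ᴳ-trans (numberᴳ-< y<x) x≤G
  ; above = λ x<y → ≤ᴳ-trans G≤x (numberᴳ-≤ (<⇒≤ x<y)) }

number-rightStop : ∀ {G} x → G ≃ numberᴳ x → IsRightStop G x
number-rightStop x (G≤x , x≤G) = record
  { below = λ y<x → ≤ᴳ-trans (numberᴳ-≤ (<⇒≤ y<x)) x≤G
  ; above = λ x<y → ≤ᴳ-⧏-trans G≤x (numberᴳ-< x<y) }

numberᴳ-split : ∀ z y → numberᴳ (z - y) ⊕ numberᴳ y ≃ numberᴳ z
numberᴳ-split z y = ≃-trans (numberᴳ-+ (z - y) y) (≃-reflexive (cong numberᴳ (m-n+n≡m y z)))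

leftStop-⊕ : ∀ {G l} y → IsLeftStop G l → IsLeftStop (G ⊕ numberᴳ y) (l + y)
leftStop-⊕ {G} {l} y s = record
  { below = λ {z} z<l+y → ≤ᴳ-⧏-trans (proj₂ (numberᴳ-split z y))
      (⊕-monoˡ-⧏ (numberᴳ y) (IsLeftStop.below s (<+⇒-< l y z<l+y)))
  ; above = λ {z} l+y<z → ≤ᴳ-trans (⊕-monoˡ (numberᴳ y) (IsLeftStop.above s (+<⇒<- l y l+y<z)))
      (proj₁ (numberᴳ-split z y)) }

rightStop-⊕ : ∀ {G r} y → IsRightStop G r → IsRightStop (G ⊕ numberᴳ y) (r + y)
rightStop-⊕ {G} {r} y s = record
  { below = λ {z} z<r+y → ≤ᴳ-trans (proj₂ (numberᴳ-split z y))
      (⊕-monoˡ (numberᴳ y) (IsRightStop.below s (<+⇒-< r y z<r+y)))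
  ; above = λ {z} r+y<z → ⧏-≤ᴳ-trans (⊕-monoˡ-⧏ (numberᴳ y)
      (IsRightStop.above s (+<⇒<- r y r+y<z))) (proj₁ (numberᴳ-split z y)) }

rightStop-≃ : ∀ {G H r} → G ≃ H → IsRightStop G r → IsRightStop H r
rightStop-≃ (G≤H , H≤G) s = record
  { below = λ y<r → ≤ᴳ-trans (IsRightStop.below s y<r) G≤H
  ; above = λ r<y → ≤ᴳ-⧏-trans H≤G (IsRightStop.above s r<y) }

leftStop-≃ : ∀ {G H l} → G ≃ H → IsLeftStop G l → IsLeftStop H l
leftStop-≃ (G≤H , H≤G) s = record
  { below = λ y<l → ⧏-≤ᴳ-trans (IsLeftStop.below s y<l) G≤H
  ; above = λ l<y → ≤ᴳ-trans H≤G (IsLeftStop.above s l<y) }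

⊝-numberᴳ : ∀ G y → G ⊕ numberᴳ (- y) ≃ G ⊝ numberᴳ y
⊝-numberᴳ G y = ⊕-cong {G} ≃-refl (≃-sym (⊖-numberᴳ y))

leftStop-⊝ : ∀ {G l} y → IsLeftStop G l → IsLeftStop (G ⊝ numberᴳ y) (l - y)
leftStop-⊝ {G} y s = leftStop-≃ (⊝-numberᴳ G y) (leftStop-⊕ (- y) s)

rightStop-⊝ : ∀ {G r} y → IsRightStop G r → IsRightStop (G ⊝ numberᴳ y) (r - y)
rightStop-⊝ {G} y s = rightStop-≃ (⊝-numberᴳ G y) (rightStop-⊕ (- y) s)

module _ {m n} {GL : Vector Game (suc m)} {GR : Vector Game (suc n)} {r : Vector ℤ[½] (suc m)}
    {l : Vector ℤ[½] (suc n)}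
         (stopsL : ∀ i → IsRightStop (GL i) (r i)) (stopsR : ∀ j → IsLeftStop (GR j) (l j)) where

  -- For y above the maximum, what could still spoil `G ≤ᴳ y` is a right option of y. By the
  -- hypothesis, the right option of G with the least left stop is ≤ y and hence ≤ that option. The
  -- argument is the same whether or not G is a number.
  leftStop-options : min l ≤ᴰ max r → IsLeftStop ⟨ GL ∣ GR ⟩ (max r)
  leftStop-options l≤r = record
    { below = λ {y} y<m → let i , eq = max-sel r in viaLeft i
                                  (IsRightStop.below (stopsL i) (subst (y <ᴰ_) eq y<m))
    ; above = λ {y} m<y → ≤-intro (λ i → IsRightStop.above (stopsL i) (≤-<-trans (≤max r i) m<y))
        (λ k → let j , eq = min-sel l in viaRight j (≤ᴳ-trans
          (IsLeftStop.above (stopsR j) (subst (_<ᴰ y) eq (≤-<-trans l≤r m<y)))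
              (numberᴳ-≤-right y k))) }

  rightStop-options : min l ≤ᴰ max r → IsRightStop ⟨ GL ∣ GR ⟩ (min l)
  rightStop-options l≤r = record
    { above = λ {y} m<y → let j , eq = min-sel l in viaRight j
                                  (IsLeftStop.above (stopsR j) (subst (_<ᴰ y) eq m<y))
    ; below = λ {y} y<m → ≤-intro
        (λ k → let i , eq = max-sel r in viaLeft i (≤ᴳ-trans (left-≤-numberᴳ y k)
          (IsRightStop.below (stopsL i) (subst (y <ᴰ_) eq (<-≤-trans y<m l≤r)))))
        (λ j → IsLeftStop.below (stopsR j) (<-≤-trans y<m (min≤ l j))) }

  fits-between-stops : max r <ᴰ min l → EqualToNumber ⟨ GL ∣ GR ⟩
  fits-between-stops r<l = let x , r<x , x<l = <-dense r<l in fits⇒number x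
    ((λ i → IsRightStop.above (stopsL i) (≤-<-trans (≤max r i) r<x)) ,
        (λ j → IsLeftStop.below (stopsR j) (<-≤-trans x<l (min≤ l j))))

-- Ties the recursive stops to the order-theoretic ones: since both exist with a common value and
-- the latter are unique, `IsLeftStop` implies `LeftStop`, and likewise on the right.
HasStops : Game → Set
HasStops G = (∃[ l ] LeftStop G l × IsLeftStop G l) × (∃[ r ] RightStop G r × IsRightStop G r)

number⇒hasStops : ∀ {G} → EqualToNumber G → HasStops G
number⇒hasStops {G} (x , G≈x) =
  (x , number G≈x , number-leftStop x (≈⇒≃ {G} {numberᴳ x} G≈x)) ,
  (x , number G≈x , number-rightStop x (≈⇒≃ {G} {numberᴳ x} G≈x))

hasStops : ∀ G → HasStops G
options-haveStops : ∀ {m n} (GL : Vector Game m) (GR : Vector Game n) →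
                    (∀ i → HasStops (GL i)) → (∀ j → HasStops (GR j)) → HasStops ⟨ GL ∣ GR ⟩
options-haveStops {zero} GL GR _ sR = let x , x<l = ∃-below (λ j → proj₁ (proj₁ (sR j))) in
  number⇒hasStops (fits⇒number x ((λ ()) , (λ j → IsLeftStop.below (proj₂ (proj₂ (proj₁ (sR j))))
      (x<l j))))
options-haveStops {suc m} {zero} GL GR sL _ = let x , r<x = ∃-above (λ i → proj₁ (proj₂ (sL i))) in
  number⇒hasStops (fits⇒number x ((λ i → IsRightStop.above (proj₂ (proj₂ (proj₂ (sL i)))) (r<x i))
      , (λ ())))
options-haveStops {suc m} {suc n} GL GR sL sR with ≤⊎> (min l) (max r)
  where
  r = λ i → proj₁ (proj₂ (sL i))
  l = λ j → proj₁ (proj₁ (sR j))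
... | inj₂ r<l = number⇒hasStops (fits-between-stops (λ i → proj₂ (proj₂ (proj₂ (sL i))))
    (λ j → proj₂ (proj₂ (proj₁ (sR j)))) r<l)
-- The only number that G can equal is its left stop, so a single comparison decides whether G is a
-- number.
... | inj₁ l≤r with ≃? ⟨ GL ∣ GR ⟩ (numberᴳ (max (λ i → proj₁ (proj₂ (sL i)))))
...   | yes G≃x = number⇒hasStops (max (λ i → proj₁ (proj₂ (sL i))) , ≃⇒≈ {⟨ GL ∣ GR ⟩} G≃x)
...   | no  G≄x = (max r , nonNumber G≉ (λ i → proj₁ (proj₂ (proj₂ (sL i)))) , leftStop) ,
                  (min l , nonNumber G≉ (λ j → proj₁ (proj₂ (proj₁ (sR j)))) , rightStop-options
                      isR isL l≤r)
  where
  r = λ i → proj₁ (proj₂ (sL i))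
  l = λ j → proj₁ (proj₁ (sR j))
  isR = λ i → proj₂ (proj₂ (proj₂ (sL i)))
  isL = λ j → proj₂ (proj₂ (proj₁ (sR j)))
  leftStop = leftStop-options isR isL l≤r
  G≉ : ¬ EqualToNumber ⟨ GL ∣ GR ⟩
  G≉ (x , G≈x) = G≄x (subst (λ x → ⟨ GL ∣ GR ⟩ ≃ numberᴳ x)
      (leftStop-unique (number-leftStop x G≃x) leftStop) G≃x)
    where G≃x = ≈⇒≃ {⟨ GL ∣ GR ⟩} {numberᴳ x} G≈x
hasStops ⟨ GL ∣ GR ⟩ = options-haveStops GL GR (λ i → hasStops (GL i)) (λ j → hasStops (GR j))

isLeftStop⇒leftStop : ∀ {G l} → IsLeftStop G l → LeftStop G l
isLeftStop⇒leftStop {G} s = let (l , stop , s′) , _ = hasStops G in subst (LeftStop G)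
                                    (leftStop-unique s′ s) stop

isRightStop⇒rightStop : ∀ {G r} → IsRightStop G r → RightStop G r
isRightStop⇒rightStop {G} s = let _ , (r , stop , s′) = hasStops G in subst (RightStop G)
                                      (rightStop-unique s′ s) stop

-- Floors and ceilings

integer-+ : ∀ m n → integer m + integer n ≡ integer (m ℤ.+ n)
integer-+ m n = value-injective (ℚ.toℚᵘ-injective (ℚᵘ.≃-trans (ℚ.toℚᵘ-homo-+ (fromℤ m) (fromℤ n))
  (ℚᵘ.*≡* (lemma m n))))
  where
  lemma : ∀ m n → (m ℤ.* 1ℤ ℤ.+ n ℤ.* 1ℤ) ℤ.* 1ℤ ≡ (m ℤ.+ n) ℤ.* 1ℤ
  lemma = solve-∀

integer-mono-≤ : ∀ {m n} → m ℤ.≤ n → integer m ≤ᴰ integer n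
integer-mono-≤ m≤n = wrap≤ (ℚ.*≤* (ℤ.*-monoʳ-≤-nonNeg 1ℤ m≤n))

integer-cancel-≤ : ∀ m n → integer m ≤ᴰ integer n → m ℤ.≤ n
integer-cancel-≤ m n (wrap≤ (ℚ.*≤* p)) = ℤ.*-cancelʳ-≤-pos m n 1ℤ p

integerᴳ-mono-≤ : ∀ {m n} → m ℤ.≤ n → integerᴳ m ≤ᴳ integerᴳ n
integerᴳ-mono-≤ = dyadicᴳ-mono-≤ 0

integerᴳ-mono-< : ∀ {m n} → m ℤ.< n → integerᴳ m ⧏ integerᴳ n
integerᴳ-mono-< = dyadicᴳ-mono-< 0

-- The analogues of right and left stops with integers in place of numbers.
record IsFloor (G : Game) (r : ℤ) : Set where
  field
    below : ∀ {n} → n ℤ.≤ r → integerᴳ n ≤ᴳ G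
    above : ∀ {n} → r ℤ.< n → G ⧏ integerᴳ n

record IsCeiling (G : Game) (c : ℤ) : Set where
  field
    below : ∀ {n} → n ℤ.< c → integerᴳ n ⧏ G
    above : ∀ {n} → c ℤ.≤ n → G ≤ᴳ integerᴳ n


integer-floor : ∀ {G n} → G ≃ integerᴳ n → IsFloor G n
integer-floor (G≤n , n≤G) = record
  { below = λ m≤n → ≤ᴳ-trans (integerᴳ-mono-≤ m≤n) n≤G ; above = λ n<m → ≤ᴳ-⧏-trans G≤n
      (integerᴳ-mono-< n<m) }

integer-ceiling : ∀ {G n} → G ≃ integerᴳ n → IsCeiling G n
integer-ceiling (G≤n , n≤G) = record
  { below = λ m<n → ⧏-≤ᴳ-trans (integerᴳ-mono-< m<n) n≤G ; above = λ n≤m → ≤ᴳ-trans G≤n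
      (integerᴳ-mono-≤ n≤m) }

suc≤right-integerᴳ : ∀ n j → integerᴳ (ℤ.suc n) ≤ᴳ right (integerᴳ n) j
suc≤right-integerᴳ = Spaced.suc≤right (spaced 0)

left≤pred-integerᴳ : ∀ n i → left (integerᴳ n) i ≤ᴳ integerᴳ (ℤ.pred n)
left≤pred-integerᴳ = Spaced.left≤pred (spaced 0)

<⇒≤pred : ∀ {m n} → m ℤ.< n → m ℤ.≤ ℤ.pred n
<⇒≤pred {m} m<n = subst (ℤ._≤ _) (ℤ.pred-suc m) (ℤ.pred-mono (ℤ.i<j⇒suc[i]≤j m<n))

≤pred⇒< : ∀ {m n} → m ℤ.≤ ℤ.pred n → m ℤ.< n
≤pred⇒< = ℤ.i≤pred[j]⇒i<j

module _ {m n} {GL : Vector Game (suc m)} {GR : Vector Game (suc n)} {r : Vector ℤ (suc m)}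
    {c : Vector ℤ (suc n)}
         (floors : ∀ i → IsFloor (GL i) (r i)) (ceilings : ∀ j → IsCeiling (GR j) (c j)) where

  private G = ⟨ GL ∣ GR ⟩

  fits-integer : ∀ k → (∀ i → ℤ.suc (r i) ℤ.≤ k) → (∀ j → k ℤ.≤ ℤ.pred (c j)) → EqualToInteger G
  fits-integer k r<k k<c = fits⇒integer k
    ((λ i → IsFloor.above (floors i) (ℤ.suc[i]≤j⇒i<j (r<k i))) ,
        (λ j → IsCeiling.below (ceilings j) (≤pred⇒< (k<c j))))

  integer-between : ∀ k → G ≃ integerᴳ k → (∀ i → ℤ.suc (r i) ℤ.≤ k) × (∀ j → k ℤ.≤ ℤ.pred (c j))
  integer-between k (G≤k , k≤G) =
    (λ i → ℤ.i<j⇒suc[i]≤j (ℤ.≰⇒> λ k≤r → ≤ᴳ⇒¬⧏ (IsFloor.below (floors i) k≤r) (left⧏ G≤k i))) ,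
    (λ j → <⇒≤pred (ℤ.≰⇒> λ c≤k → ≤ᴳ⇒¬⧏ (IsCeiling.above (ceilings j) c≤k) (⧏right k≤G j)))

  module _ (G≉ : ¬ EqualToInteger G) where

    -- The counterpart of `leftStop-options`. Non-integrality takes the place of the inequality
    -- between the stops: a right option of p that is ≤ G would put p + 1 below G, so that p + 1
    -- would fit between the options of G.
    ceiling-options : ∀ {k} → (∀ i → ℤ.suc (r i) ℤ.≤ k) → ∃[ i ] k ≡ ℤ.suc (r i) → IsCeiling G k
    ceiling-options {k} r<k (i , k≡) = record
      { below = λ {p} p<k → viaLeft i (IsFloor.below (floors i)
          (subst (p ℤ.≤_) (trans (cong ℤ.pred k≡) (ℤ.pred-suc (r i))) (<⇒≤pred p<k)))
      ; above = λ {p} k≤p → ≤-intro (GL⧏ k≤p) (⧏right-integer k≤p) }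
      where
      GL⧏ : ∀ {p} → k ℤ.≤ p → ∀ i → GL i ⧏ integerᴳ p
      GL⧏ k≤p i = IsFloor.above (floors i) (ℤ.suc[i]≤j⇒i<j (ℤ.≤-trans (r<k i) k≤p))
      ⧏right-integer : ∀ {p} → k ℤ.≤ p → ∀ j → G ⧏ right (integerᴳ p) j
      ⧏right-integer {p} k≤p j with ≤ᴳ⊎⧏ (right (integerᴳ p) j) G
      ... | inj₂ G⧏ = G⧏
      ... | inj₁ ≤G = contradiction (fits⇒integer (ℤ.suc p)
        ((λ i → ⧏-≤ᴳ-trans (GL⧏ k≤p i) (integerᴳ-≤-suc p)) ,
         (λ i → ≤ᴳ-⧏-trans (≤ᴳ-trans (suc≤right-integerᴳ p j) ≤G) (⧏-right G i)))) G≉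

    floor-options : ∀ {k} → (∀ j → k ℤ.≤ ℤ.pred (c j)) → ∃[ j ] k ≡ ℤ.pred (c j) → IsFloor G k
    floor-options {k} k<c (j , k≡) = record
      { above = λ {p} k<p → viaRight j (IsCeiling.above (ceilings j)
          (subst (ℤ._≤ p) (trans (cong ℤ.suc k≡) (ℤ.suc-pred (c j))) (ℤ.i<j⇒suc[i]≤j k<p)))
      ; below = λ {p} p≤k → ≤-intro (left-integer⧏ p≤k) (⧏GR p≤k) }
      where
      ⧏GR : ∀ {p} → p ℤ.≤ k → ∀ j → integerᴳ p ⧏ GR j
      ⧏GR p≤k j = IsCeiling.below (ceilings j) (≤pred⇒< (ℤ.≤-trans p≤k (k<c j)))
      left-integer⧏ : ∀ {p} → p ℤ.≤ k → ∀ i → left (integerᴳ p) i ⧏ G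
      left-integer⧏ {p} p≤k i with ≤ᴳ⊎⧏ G (left (integerᴳ p) i)
      ... | inj₂ ⧏G = ⧏G
      ... | inj₁ G≤ = contradiction (fits⇒integer (ℤ.pred p)
        ((λ j → ⧏-≤ᴳ-trans (left-⧏ G j) (≤ᴳ-trans G≤ (left≤pred-integerᴳ p i))) ,
         (λ j → ≤ᴳ-⧏-trans (Spaced.pred-≤ (spaced 0) p) (⧏GR p≤k j)))) G≉

<min-integer : ∀ {n} (c : Vector ℤ n) → ∃[ k ] (∀ j → k ℤ.< c j)
<min-integer {zero}  c = 0ℤ , λ ()
<min-integer {suc n} c = let k , k<c = <min-integer (c ∘ suc) in
  ℤ.pred (c zero) ℤ.⊓ k , λ { zero → ≤pred⇒< (ℤ.i⊓j≤i (ℤ.pred (c zero)) k) ; (suc j) → ℤ.≤-<-trans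
      (ℤ.i⊓j≤j (ℤ.pred (c zero)) k) (k<c j) }

max<integer : ∀ {n} (r : Vector ℤ n) → ∃[ k ] (∀ i → r i ℤ.< k)
max<integer {zero}  r = 0ℤ , λ ()
max<integer {suc n} r = let k , r<k = max<integer (r ∘ suc) in
  ℤ.suc (r zero) ℤ.⊔ k , λ { zero → ℤ.suc[i]≤j⇒i<j (ℤ.i≤i⊔j (ℤ.suc (r zero)) k) ; (suc i) →
      ℤ.<-≤-trans (r<k i) (ℤ.i≤j⊔i (ℤ.suc (r zero)) k) }

-- Piecewise linear functions

Domain : Set₁
Domain = ℤ[½] → Set

-- A tree of cuts. They may come in any order and may miss the domain, so that restriction and
-- maxima are structural; only the conversion to a trajectory sorts them. Both sides of a cut
-- contain it, so neighbouring pieces meet there.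
data Piecewise (X : Domain → Set) (I : Domain) : Set₁ where
  leaf  : X I → Piecewise X I
  split : ∀ c → Piecewise X (λ x → I x × x ≤ᴰ c) → Piecewise X (λ x → I x × c ≤ᴰ x) → Piecewise X I

Restrictable : (Domain → Set) → Set₁
Restrictable X = ∀ {I J : Domain} → (∀ x → J x → I x) → X I → X J

restrict : ∀ {X I J} → Restrictable X → (∀ x → J x → I x) → Piecewise X I → Piecewise X J
restrict res J⊆I (leaf p)      = leaf (res J⊆I p)
restrict res J⊆I (split c p q) = split c
  (restrict res (λ x (Jx , x≤c) → J⊆I x Jx , x≤c) p) (restrict res
      (λ x (Jx , c≤x) → J⊆I x Jx , c≤x) q)

-- A piece may be cut again, as where two lines cross. The inclusion handed to `f` lets a second
-- function be restricted to the piece at hand, which is how `zipWith` refines two subdivisions.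
bind : ∀ {X Y I} → (∀ {J} → (∀ x → J x → I x) → X J → Piecewise Y J) → Piecewise X I → Piecewise Y I
bind f (leaf p)      = f (λ _ Ix → Ix) p
bind f (split c p q) = split c (bind (λ J⊆ → f (λ x Jx → proj₁ (J⊆ x Jx))) p)
    (bind (λ J⊆ → f (λ x Jx → proj₁ (J⊆ x Jx))) q)

map : ∀ {X Y I} → (∀ {J} → X J → Y J) → Piecewise X I → Piecewise Y I
map f = bind (λ _ p → leaf (f p))

zipWith : ∀ {X Y Z I} → Restrictable X → Restrictable Y →
          (∀ {J} → X J → Y J → Piecewise Z J) → Piecewise X I → Piecewise Y I → Piecewise Z I
zipWith resX resY f p q = bind (λ J⊆I x → bind (λ K⊆J y → f (resX K⊆J x) y) (restrict resY J⊆I q)) p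

data Piece (f : ℤ[½] → ℤ[½]) (I : Domain) : Set where
  constant : ∀ b → (∀ x → I x → f x ≡ b) → Piece f I
  falling  : ∀ b → (∀ x → I x → f x + x ≡ b) → Piece f I

piece-restrict : ∀ {f} → Restrictable (Piece f)
piece-restrict J⊆I (constant b eq) = constant b (λ x Jx → eq x (J⊆I x Jx))
piece-restrict J⊆I (falling b eq)  = falling b (λ x Jx → eq x (J⊆I x Jx))

piece-cong : ∀ {f g I} → (∀ x → I x → f x ≡ g x) → Piece f I → Piece g I
piece-cong f≡g (constant b eq) = constant b (λ x Ix → trans (sym (f≡g x Ix)) (eq x Ix))
piece-cong f≡g (falling b eq)  = falling b (λ x Ix → trans (cong (_+ x) (sym (f≡g x Ix))) (eq x Ix))

⊔-right : ∀ {x y} → x ≤ᴰ y → x ⊔ y ≡ y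
⊔-right {x} {y} (wrap≤ p) = value-injective (Max.x≤y⇒x⊔y≈y {y} {x} p)

⊔-left : ∀ {x y} → y ≤ᴰ x → x ⊔ y ≡ x
⊔-left {x} {y} (wrap≤ p) = value-injective (Max.x≤y⇒y⊔x≈y {x} {y} p)

-- `h` stands for the maximum with its arguments in either order. The cut is where the line c - x
-- takes the value b.
max-constant-falling : ∀ {f g : ℤ[½] → ℤ[½]} {I : Domain} b c → (∀ x → I x → f x ≡ b) →
    (∀ x → I x → g x + x ≡ c) →
  (h : ℤ[½] → ℤ[½]) → (∀ x → f x ≤ᴰ g x → h x ≡ g x) → (∀ x → g x ≤ᴰ f x → h x ≡ f x) → Piecewise
      (Piece h) I
max-constant-falling {f} {g} b c f≡b g+x≡c h h≡g h≡f = split (c - b)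
  (leaf (falling c λ x (Ix , x≤c-b) → trans (cong (_+ x) (h≡g x (subst (_≤ᴰ g x) (sym (f≡b x Ix))
    (+-cancelʳ-≤ b (g x) x (subst (b + x ≤ᴰ_) (trans (trans (+-comm b (c - b)) (m-n+n≡m b c))
        (sym (g+x≡c x Ix))) (+-monoʳ-≤ b x≤c-b))))))
    (g+x≡c x Ix)))
  (leaf (constant b λ x (Ix , c-b≤x) → trans (h≡f x (subst (g x ≤ᴰ_) (sym (f≡b x Ix))
    (+-cancelʳ-≤ (g x) b x (subst (_≤ᴰ b + x) (trans (trans (+-comm b (c - b)) (m-n+n≡m b c))
        (sym (g+x≡c x Ix))) (+-monoʳ-≤ b c-b≤x)))))
    (f≡b x Ix)))

max-piece : ∀ {f g I} → Piece f I → Piece g I → Piecewise (Piece (λ x → f x ⊔ g x)) I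
max-piece (constant b f≡b) (constant c g≡c) = leaf (constant (b ⊔ c) λ x Ix → cong₂ _⊔_ (f≡b x Ix)
    (g≡c x Ix))
max-piece {f} {g} (constant b f≡b) (falling c g+x≡c) =
  max-constant-falling {f} {g} b c f≡b g+x≡c (λ x → f x ⊔ g x) (λ x → ⊔-right {f x} {g x})
      (λ x → ⊔-left {f x} {g x})
max-piece {f} {g} (falling b f+x≡b) (constant c g≡c) =
  max-constant-falling {g} {f} c b g≡c f+x≡b (λ x → f x ⊔ g x) (λ x → ⊔-left {f x} {g x})
      (λ x → ⊔-right {f x} {g x})
max-piece {f} {g} (falling b f+x≡b) (falling c g+x≡c) with ≤-total b c
... | inj₁ b≤c = leaf (falling c λ x Ix → trans (cong (_+ x) (⊔-right
  (+-cancelʳ-≤ (f x) (g x) x (subst₂ _≤ᴰ_ (sym (f+x≡b x Ix)) (sym (g+x≡c x Ix)) b≤c))))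
      (g+x≡c x Ix))
... | inj₂ c≤b = leaf (falling b λ x Ix → trans (cong (_+ x) (⊔-left
  (+-cancelʳ-≤ (g x) (f x) x (subst₂ _≤ᴰ_ (sym (g+x≡c x Ix)) (sym (f+x≡b x Ix)) c≤b))))
      (f+x≡b x Ix))

Everywhere : Domain
Everywhere _ = ⊤

-- The two inequalities are consequences of the slopes, but they are awkward to extract from the
-- tree, so they are carried along. `steep` bounds the slope below by -1. It amounts to antitonicity
-- of `tax f`, and `falling-tax` exchanges the two.
record Falling (f : ℤ[½] → ℤ[½]) : Set₁ where
  field
    pieces   : Piecewise (Piece f) Everywhere
    antitone : ∀ {x y} → x ≤ᴰ y → f y ≤ᴰ f x
    steep    : ∀ {x y} → x ≤ᴰ y → f x + x ≤ᴰ f y + y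

falling-cong : ∀ {f g} → (∀ x → f x ≡ g x) → Falling f → Falling g
falling-cong f≡g F = record
  { pieces   = map (piece-cong (λ x _ → f≡g x)) pieces
  ; antitone = λ {x} {y} x≤y → subst₂ _≤ᴰ_ (f≡g y) (f≡g x) (antitone x≤y)
  ; steep    = λ {x} {y} x≤y → subst₂ _≤ᴰ_ (cong (_+ x) (f≡g x)) (cong (_+ y) (f≡g y)) (steep x≤y) }
  where open Falling F

falling-constant : ∀ b → Falling (λ _ → b)
falling-constant b = record
  { pieces = leaf (constant b λ _ _ → refl) ; antitone = λ _ → ≤-refl ; steep = λ x≤y → +-monoʳ-≤
      b x≤y }

-- With f = λ_t of a right option this is -(f t + t), a candidate for -ρ̃; with
-- f = -ρ_t of a left option it is ρ_t - t, a candidate for λ̃.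
tax : (ℤ[½] → ℤ[½]) → ℤ[½] → ℤ[½]
tax f t = - (f t + t)

tax+x : ∀ (f : ℤ[½] → ℤ[½]) x → tax f x + x ≡ - f x
tax+x f x = neg-+-cancel (f x) x

falling-tax : ∀ {f} → Falling f → Falling (tax f)
falling-tax {f} F = record
  { pieces = map (λ { (constant b eq) → falling (- b) λ x Ix → trans (tax+x f x)
      (cong (λ y → - y) (eq x Ix))
                    ; (falling b eq) → constant (- b) λ x Ix → cong (λ y → - y) (eq x Ix) }) pieces
  ; antitone = λ x≤y → neg-anti-≤ (steep x≤y)
  ; steep = λ {x} {y} x≤y → subst₂ _≤ᴰ_ (sym (tax+x f x)) (sym (tax+x f y))
      (neg-anti-≤ (antitone x≤y)) }
  where open Falling F

⊔-mono : ∀ {x y z w} → x ≤ᴰ y → z ≤ᴰ w → x ⊔ z ≤ᴰ y ⊔ w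
⊔-mono {x} {y} {z} {w} (wrap≤ p) (wrap≤ q) = wrap≤ (Max.⊔-mono-≤ {y} {x} {w} {z} p q)

+-distribʳ-⊔ : ∀ x y z → (x ⊔ y) + z ≡ (x + z) ⊔ (y + z)
+-distribʳ-⊔ x y z with ≤-total x y
... | inj₁ x≤y = trans (cong (_+ z) (⊔-right x≤y)) (sym (⊔-right (+-monoˡ-≤ z x≤y)))
... | inj₂ y≤x = trans (cong (_+ z) (⊔-left y≤x)) (sym (⊔-left (+-monoˡ-≤ z y≤x)))

falling-max : ∀ {n} {f : Fin (suc n) → ℤ[½] → ℤ[½]} → (∀ i → Falling (f i)) → Falling
    (λ t → max (λ i → f i t))
falling-max {zero}  F = F zero
falling-max {suc n} {f} F = record
  { pieces = zipWith piece-restrict piece-restrict max-piece (pieces (F zero)) (pieces G)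
  ; antitone = λ x≤y → ⊔-mono (antitone (F zero) x≤y) (antitone G x≤y)
  ; steep = λ {x} {y} x≤y → subst₂ _≤ᴰ_ (sym (+-distribʳ-⊔ (f zero x) (g x) x))
      (sym (+-distribʳ-⊔ (f zero y) (g y) y))
                              (⊔-mono (steep (F zero) x≤y) (steep G x≤y)) }
  where
  open Falling
  g : ℤ[½] → ℤ[½]
  g t = max (λ i → f (suc i) t)
  G : Falling g
  G = falling-max (λ i → F (suc i))

-- `λₜ` and `ρₜ` unfold to this definitionally in the `nonInteger` case.
truncate : (ℤ[½] → ℤ[½]) → ℤ[½] → ℤ[½] → ℤ[½]
truncate f τ t = if does (t ≤? τ) then f t else f τ

if-yes : ∀ {P A : Set} (P? : Dec P) {x y : A} → P → (if does P? then x else y) ≡ x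
if-yes (yes _) _ = refl
if-yes (no ¬p) p = contradiction p ¬p

if-no : ∀ {P A : Set} (P? : Dec P) {x y : A} → ¬ P → (if does P? then x else y) ≡ y
if-no (yes p) ¬p = contradiction p ¬p
if-no (no _)  _  = refl

truncate-below : ∀ f {τ t} → t ≤ᴰ τ → truncate f τ t ≡ f t
truncate-below f {τ} {t} t≤τ = if-yes (t ≤? τ) (unwrap≤ t≤τ)

truncate-above : ∀ f {τ t} → τ ≤ᴰ t → truncate f τ t ≡ f τ
truncate-above f {τ} {t} τ≤t = by-cases (t ≤? τ) λ t≤τ → cong f (≤-antisym (wrap≤ t≤τ) τ≤t)
  where
  by-cases : ∀ {P : Set} (P? : Dec P) → (P → f t ≡ f τ) → (if does P? then f t else f τ) ≡ f τ
  by-cases (yes p) eq = eq p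
  by-cases (no _)  _  = refl

falling-truncate : ∀ {f} τ → Falling f → Falling (truncate f τ)
falling-truncate {f} τ F = record
  { pieces = split τ
      (bind (λ J⊆ p → leaf (piece-cong (λ x Jx → sym (truncate-below f (proj₂ (J⊆ x Jx)))) p))
          (restrict piece-restrict (λ _ _ → tt) pieces))
      (leaf (constant (f τ) (λ x (_ , τ≤x) → truncate-above f τ≤x)))
  ; antitone = λ {x} {y} x≤y → anti (≤-total x τ) (≤-total y τ) x≤y
  ; steep = λ {x} {y} x≤y → mono (≤-total x τ) (≤-total y τ) x≤y }
  where
  open Falling F
  g = truncate f τ
  anti : ∀ {x y} → x ≤ᴰ τ ⊎ τ ≤ᴰ x → y ≤ᴰ τ ⊎ τ ≤ᴰ y → x ≤ᴰ y → g y ≤ᴰ g x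
  anti (inj₁ x≤τ) (inj₁ y≤τ) x≤y = subst₂ _≤ᴰ_ (sym (truncate-below f y≤τ))
      (sym (truncate-below f x≤τ)) (antitone x≤y)
  anti (inj₁ x≤τ) (inj₂ τ≤y) x≤y = subst₂ _≤ᴰ_ (sym (truncate-above f τ≤y))
      (sym (truncate-below f x≤τ)) (antitone x≤τ)
  anti (inj₂ τ≤x) _ x≤y = ≤-reflexive (trans (truncate-above f (≤-trans τ≤x x≤y))
      (sym (truncate-above f τ≤x)))
  mono : ∀ {x y} → x ≤ᴰ τ ⊎ τ ≤ᴰ x → y ≤ᴰ τ ⊎ τ ≤ᴰ y → x ≤ᴰ y → g x + x ≤ᴰ g y + y
  mono {x} {y} (inj₁ x≤τ) (inj₁ y≤τ) x≤y = subst₂ _≤ᴰ_ (cong (_+ x) (sym (truncate-below f x≤τ)))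
      (cong (_+ y) (sym (truncate-below f y≤τ))) (steep x≤y)
  mono {x} {y} (inj₁ x≤τ) (inj₂ τ≤y) x≤y = subst₂ _≤ᴰ_ (cong (_+ x) (sym (truncate-below f x≤τ)))
      (cong (_+ y) (sym (truncate-above f τ≤y)))
    (≤-trans (steep x≤τ) (+-monoʳ-≤ (f τ) τ≤y))
  mono {x} {y} (inj₂ τ≤x) _ x≤y = subst₂ _≤ᴰ_ (cong (_+ x) (sym (truncate-above f τ≤x)))
      (cong (_+ y) (sym (truncate-above f (≤-trans τ≤x x≤y))))
    (+-monoʳ-≤ (f τ) x≤y)

-- The first zero of a nonincreasing piecewise linear function

data SumPiece (s : ℤ[½] → ℤ[½]) (I : Domain) : Set where
  slope0 : ∀ b → (∀ x → I x → s x ≡ b) → SumPiece s I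
  slope1 : ∀ b → (∀ x → I x → s x + x ≡ b) → SumPiece s I
  slope2 : ∀ b → (∀ x → I x → s x + (x + x) ≡ b) → SumPiece s I

interchange : ∀ a b x y → (a + b) + (x + y) ≡ (a + x) + (b + y)
interchange a b x y = trans (+-assoc a b (x + y)) (trans
    (cong (λ z → a + z) (trans (sym (+-assoc b x y))
  (trans (cong (_+ y) (+-comm b x)) (+-assoc x b y)))) (sym (+-assoc a x (b + y))))

sum-piece : ∀ {f g I} → Piece f I → Piece g I → SumPiece (λ x → f x + g x) I
sum-piece (constant b f≡b) (constant c g≡c) = slope0 (b + c) λ x Ix → cong₂ _+_ (f≡b x Ix)
    (g≡c x Ix)
sum-piece {f} {g} (constant b f≡b) (falling c g≡c) = slope1 (b + c) λ x Ix →
  trans (+-assoc (f x) (g x) x) (cong₂ _+_ (f≡b x Ix) (g≡c x Ix))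
sum-piece {f} {g} (falling b f≡b) (constant c g≡c) = slope1 (b + c) λ x Ix →
  trans (trans (+-assoc (f x) (g x) x) (trans (cong (λ z → f x + z) (+-comm (g x) x))
      (sym (+-assoc (f x) x (g x)))))
        (cong₂ _+_ (f≡b x Ix) (g≡c x Ix))
sum-piece {f} {g} (falling b f≡b) (falling c g≡c) = slope2 (b + c) λ x Ix →
  trans (interchange (f x) (g x) x x) (cong₂ _+_ (f≡b x Ix) (g≡c x Ix))

0ᴰ : ℤ[½]
0ᴰ = integer 0ℤ

+≡⇒≡0 : ∀ x {y} → x + y ≡ y → x ≡ 0ᴰ
+≡⇒≡0 x {y} eq = trans (sym (m+n-n≡m y x)) (trans (cong (_- y) eq) (+-inverseʳ y))

0<⇒<+ : ∀ {s} x → 0ᴰ <ᴰ s → x <ᴰ s + x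
0<⇒<+ {s} x 0<s = subst (_<ᴰ s + x) (+-identityˡ x) (+-monoˡ-< x 0<s)

<+⇒0< : ∀ s x → x <ᴰ s + x → 0ᴰ <ᴰ s
<+⇒0< s x p = +-cancelʳ-< 0ᴰ s x (subst (_<ᴰ s + x) (sym (+-identityˡ x)) p)

≤0⇒+≤ : ∀ {s} x → s ≤ᴰ 0ᴰ → s + x ≤ᴰ x
≤0⇒+≤ {s} x s≤0 = subst (s + x ≤ᴰ_) (+-identityˡ x) (+-monoˡ-≤ x s≤0)

module _ {s : ℤ[½] → ℤ[½]} (antitone : ∀ {x y} → x ≤ᴰ y → s y ≤ᴰ s x) where

  FirstZero : ℤ[½] → Set
  FirstZero lo = ∃[ τ ] s τ ≡ 0ᴰ × (∀ y → lo ≤ᴰ y → y <ᴰ τ → 0ᴰ <ᴰ s y)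

  -- The intermediate value theorem, searching along the cuts: the sign of s at a cut inside the
  -- interval tells which side holds the first zero, and if that is the right side, antitonicity
  -- keeps s positive on the left one.
  firstZero-between : ∀ {I lo hi} → Piecewise (SumPiece s) I → (∀ x → lo ≤ᴰ x → x ≤ᴰ hi → I x) →
                      lo ≤ᴰ hi → 0ᴰ <ᴰ s lo → s hi ≤ᴰ 0ᴰ → FirstZero lo
  firstZero-between {lo = lo} {hi} (leaf (slope0 b s≡b)) ⊆I lo≤hi 0<s s≤0 =
    contradiction (subst (_≤ᴰ 0ᴰ) (trans (s≡b hi (⊆I hi lo≤hi ≤-refl))
        (sym (s≡b lo (⊆I lo ≤-refl lo≤hi)))) s≤0) (<⇒≱ 0<s)
  firstZero-between {lo = lo} {hi} (leaf (slope1 b s≡b)) ⊆I lo≤hi 0<s s≤0 =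
    -- On this piece s x = b - x, so the zero is b; the signs of s at the ends place it between
    -- them.
    b , +≡⇒≡0 (s b) (s≡b b (⊆I b lo≤b b≤hi)) ,
    λ y lo≤y y<b → <+⇒0< (s y) y (subst (y <ᴰ_) (sym (s≡b y (⊆I y lo≤y (≤-trans (<⇒≤ y<b) b≤hi))))
        y<b)
    where
    lo≤b : lo ≤ᴰ b
    lo≤b = <⇒≤ (subst (lo <ᴰ_) (s≡b lo (⊆I lo ≤-refl lo≤hi)) (0<⇒<+ lo 0<s))
    b≤hi : b ≤ᴰ hi
    b≤hi = subst (_≤ᴰ hi) (s≡b hi (⊆I hi lo≤hi ≤-refl)) (≤0⇒+≤ hi s≤0)
  firstZero-between {lo = lo} {hi} (leaf (slope2 b s≡b)) ⊆I lo≤hi 0<s s≤0 =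
    -- Here s x = b - 2x. This is the steepest case, so solving for a zero takes at most a halving
    -- and the result stays dyadic.
    h , +≡⇒≡0 (s h) (trans (s≡b h (⊆I h lo≤h h≤hi)) (sym (half+half b))) ,
    λ y lo≤y y<h → <+⇒0< (s y) (y + y) (subst (y + y <ᴰ_)
        (sym (s≡b y (⊆I y lo≤y (≤-trans (<⇒≤ y<h) h≤hi))))
      (subst (y + y <ᴰ_) (half+half b) (<-≤-trans (+-monoˡ-< y y<h) (+-monoʳ-≤ h (<⇒≤ y<h)))))
    where
    h = half b
    lo≤h : lo ≤ᴰ h
    lo≤h = ≤-from-double lo h (subst (lo + lo ≤ᴰ_) (sym (half+half b))
      (<⇒≤ (subst (lo + lo <ᴰ_) (s≡b lo (⊆I lo ≤-refl lo≤hi)) (0<⇒<+ (lo + lo) 0<s))))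
    h≤hi : h ≤ᴰ hi
    h≤hi = ≤-from-double h hi (subst (_≤ᴰ hi + hi) (trans (s≡b hi (⊆I hi lo≤hi ≤-refl))
        (sym (half+half b))) (≤0⇒+≤ (hi + hi) s≤0))
  firstZero-between {lo = lo} {hi} (split c p q) ⊆I lo≤hi 0<s s≤0 with ≤-total c lo | ≤-total hi c
      | ≤⊎> (s c) 0ᴰ
  ... | inj₁ c≤lo | _         | _ = firstZero-between q
      (λ x lo≤x x≤hi → ⊆I x lo≤x x≤hi , ≤-trans c≤lo lo≤x) lo≤hi 0<s s≤0
  ... | inj₂ _    | inj₁ hi≤c | _ = firstZero-between p
      (λ x lo≤x x≤hi → ⊆I x lo≤x x≤hi , ≤-trans x≤hi hi≤c) lo≤hi 0<s s≤0
  ... | inj₂ lo≤c | inj₂ c≤hi | inj₁ sc≤0 =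
    firstZero-between p (λ x lo≤x x≤c → ⊆I x lo≤x (≤-trans x≤c c≤hi) , x≤c) lo≤c 0<s sc≤0
  ... | inj₂ lo≤c | inj₂ c≤hi | inj₂ 0<sc =
    let τ , eq , pos = firstZero-between q (λ x c≤x x≤hi → ⊆I x (≤-trans lo≤c c≤x) x≤hi , c≤x)
            c≤hi 0<sc s≤0
    in τ , eq , λ y lo≤y y<τ → positive pos y y<τ (≤-total c y)
    where
    positive : ∀ {τ} → (∀ y → c ≤ᴰ y → y <ᴰ τ → 0ᴰ <ᴰ s y) → ∀ y → y <ᴰ τ → c ≤ᴰ y ⊎ y ≤ᴰ c → 0ᴰ
        <ᴰ s y
    positive pos y y<τ (inj₁ c≤y) = pos y c≤y y<τ
    positive pos y y<τ (inj₂ y≤c) = <-≤-trans 0<sc (antitone y≤c)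

-- Applied to f = λ̃ and g = -ρ̃. The search starts at lo, but τ is least in all of ℤ[½], since by
-- antitonicity f + g is positive to the left of lo as well.
leastMeeting : ∀ {f g lo hi} → Falling f → Falling g → lo ≤ᴰ hi →
               0ᴰ <ᴰ f lo + g lo → f hi + g hi ≤ᴰ 0ᴰ → ∃[ τ ] IsLeast (λ t → f t ≡ - g t) τ
leastMeeting {f} {g} {lo} F G lo≤hi 0<s s≤0 =
  let τ , eq , pos = firstZero-between antitone
        (zipWith piece-restrict piece-restrict (λ p q → leaf (sum-piece p q)) (Falling.pieces F)
            (Falling.pieces G))
        (λ _ _ _ → tt) lo≤hi 0<s s≤0
  in τ , +≡0⇒≡-neg (f τ) (g τ) eq , λ y fy≡-gy → unwrap≤
      (least τ pos y (trans (cong (_+ g y) fy≡-gy) (+-inverseˡ (g y))))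
  where
  s : ℤ[½] → ℤ[½]
  s x = f x + g x
  antitone : ∀ {x y} → x ≤ᴰ y → s y ≤ᴰ s x
  antitone x≤y = +-mono-≤ (Falling.antitone F x≤y) (Falling.antitone G x≤y)
  least : ∀ τ → (∀ y → lo ≤ᴰ y → y <ᴰ τ → 0ᴰ <ᴰ s y) → ∀ y → s y ≡ 0ᴰ → τ ≤ᴰ y
  least τ pos y sy≡0 = ≮⇒≥ λ y<τ → <⇒≱ (positive y<τ (≤-total lo y)) (≤-reflexive sy≡0)
    where
    positive : y <ᴰ τ → lo ≤ᴰ y ⊎ y ≤ᴰ lo → 0ᴰ <ᴰ s y
    positive y<τ (inj₁ lo≤y) = pos y lo≤y y<τ
    positive y<τ (inj₂ y≤lo) = <-≤-trans 0<s (antitone y≤lo)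

-- Diadic trajectories from pieces

record Line (A : List ℤ) (f : ℤ[½] → ℤ[½]) (I : Domain) : Set where
  constructor mkLine
  field
    slope     : ℤ
    slope∈    : slope ∈ A
    intercept : ℤ[½]
    equation  : ∀ x → I x → f x ≡ line slope intercept x

line-restrict : ∀ {A f} → Restrictable (Line A f)
line-restrict J⊆I (mkLine a a∈ b eq) = mkLine a a∈ b (λ x Jx → eq x (J⊆I x Jx))

-- Passing to the left of every cut below c leaves a single line, whose end j becomes the first
-- breakpoint. In the application c is a point from which f is constant.
leftRay : ∀ {A f I} → Piecewise (Line A f) I → ∀ c → (∀ x → x ≤ᴰ c → I x) →
          ∃[ j ] j ≤ᴰ c × Line A f (_≤ᴰ j)
leftRay (leaf p)       c ⊆I = c , ≤-refl , line-restrict ⊆I p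
leftRay (split c′ p q) c ⊆I with ≤-total c c′
... | inj₁ c≤c′ = leftRay p c (λ x x≤c → ⊆I x x≤c , ≤-trans x≤c c≤c′)
... | inj₂ c′≤c = let j , j≤c′ , l = leftRay p c′ (λ x x≤c′ → ⊆I x (≤-trans x≤c′ c′≤c) , x≤c′)
                  in j , ≤-trans j≤c′ c′≤c , l

-- The index is the abscissa at which the path starts.
data Path (A : List ℤ) (f : ℤ[½] → ℤ[½]) (v : ℤ[½]) : ℤ[½] → Set where
  mast : ∀ {j} → (∀ x → j ≤ᴰ x → f x ≡ v) → Path A f v j
  step : ∀ {j k} → j ≤ᴰ k → Line A f (λ x → j ≤ᴰ x × x ≤ᴰ k) → Path A f v k → Path A f v j

extend : ∀ {A f v I lo hi} → Piecewise (Line A f) I → lo ≤ᴰ hi → (∀ x → lo ≤ᴰ x → x ≤ᴰ hi → I x) →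
         Path A f v hi → Path A f v lo
extend (leaf p) lo≤hi ⊆I path = step lo≤hi (line-restrict (λ x (lo≤x , x≤hi) → ⊆I x lo≤x x≤hi) p)
    path
extend {lo = lo} {hi} (split c p q) lo≤hi ⊆I path with ≤-total c lo | ≤-total hi c
... | inj₁ c≤lo | _         = extend q lo≤hi (λ x lo≤x x≤hi → ⊆I x lo≤x x≤hi , ≤-trans c≤lo lo≤x)
    path
... | inj₂ _    | inj₁ hi≤c = extend p lo≤hi (λ x lo≤x x≤hi → ⊆I x lo≤x x≤hi , ≤-trans x≤hi hi≤c)
    path
... | inj₂ lo≤c | inj₂ c≤hi = extend p lo≤c (λ x lo≤x x≤c → ⊆I x lo≤x (≤-trans x≤c c≤hi) , x≤c)
                                (extend q c≤hi (λ x c≤x x≤hi → ⊆I x (≤-trans lo≤c c≤x) x≤hi , c≤x)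
                                    path)

-- A trajectory without its initial half line: piece i starts at j i, and the final piece is the
-- mast. Adjacent lines join because both take the value of f at the breakpoint, one by `at-start`
-- and the other by `middle`.
record Rest (A : List ℤ) (f : ℤ[½] → ℤ[½]) (v start : ℤ[½]) : Set where
  field
    n         : ℕ
    j         : Vector ℤ[½] (suc n)
    a         : Vector ℤ (suc n)
    b         : Vector ℤ[½] (suc n)
    a∈        : ∀ i → a i ∈ A
    j-start   : j zero ≡ start
    j-sorted  : ∀ (i : Fin n) → j (inject₁ i) ≤ᴰ j (suc i)
    middle    : ∀ (i : Fin n) x → j (inject₁ i) ≤ᴰ x → x ≤ᴰ j (suc i) → f x ≡ line (a (inject₁ i))
        (b (inject₁ i)) x
    last      : ∀ x → j (fromℕ n) ≤ᴰ x → f x ≡ line (a (fromℕ n)) (b (fromℕ n)) x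
    at-start  : ∀ i → f (j i) ≡ line (a i) (b i) (j i)
    last-a    : a (fromℕ n) ≡ 0ℤ
    last-b    : b (fromℕ n) ≡ v

line-0 : ∀ b x → line 0ℤ b x ≡ b
line-0 b x = trans (cong (_+ b) (value-injective {integer 0ℤ * x} {integer 0ℤ}
    (ℚ.*-zeroˡ (value x)))) (+-identityˡ b)

line-1 : ∀ b x → line 1ℤ b x ≡ x + b
line-1 b x = cong (_+ b) (value-injective {integer 1ℤ * x} {x} (ℚ.*-identityˡ (value x)))

line--1 : ∀ b x → line -1ℤ b x ≡ b - x
line--1 b x = trans (cong (_+ b) (value-injective {integer -1ℤ * x} { - x}
    (trans (sym (ℚ.neg-distribˡ-* ℚ.1ℚ (value x))) (cong ℚ.-_ (ℚ.*-identityˡ (value x))))))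
    (+-comm (- x) b)

rest : ∀ {A f v s} → 0ℤ ∈ A → Path A f v s → Rest A f v s
rest {A} {f} {v} {s} 0∈A (mast eq) = record
  { n = 0 ; j = λ _ → s ; a = λ _ → 0ℤ ; b = λ _ → v ; a∈ = λ _ → 0∈A ; j-start = refl
  ; j-sorted = λ () ; middle = λ () ; last = on-mast ; at-start = λ { zero → on-mast s ≤-refl }
  ; last-a = refl ; last-b = refl }
  where
  on-mast : ∀ x → s ≤ᴰ x → f x ≡ line 0ℤ v x
  on-mast x s≤x = trans (eq x s≤x) (sym (line-0 v x))
rest {A} {f} {v} {s} 0∈A (step {k = k} s≤k (mkLine a a∈ b eq) path) = record
  { n = suc R.n
  ; j = s Vec.∷ R.j
  ; a = a Vec.∷ R.a
  ; b = b Vec.∷ R.b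
  ; a∈ = λ { zero → a∈ ; (suc i) → R.a∈ i }
  ; j-start = refl
  ; j-sorted = λ { zero → subst (s ≤ᴰ_) (sym R.j-start) s≤k ; (suc i) → R.j-sorted i }
  ; middle = λ { zero x s≤x x≤j → eq x (s≤x , subst (x ≤ᴰ_) R.j-start x≤j) ; (suc i) → R.middle i }
  ; last = R.last
  ; at-start = λ { zero → eq s (≤-refl , s≤k) ; (suc i) → R.at-start i }
  ; last-a = R.last-a
  ; last-b = R.last-b }
  where module R = Rest (rest 0∈A path)

Slopes : List ℤ
Slopes = -1ℤ ∷ 0ℤ ∷ 1ℤ ∷ []

TrajectoryWithMast : List ℤ → (ℤ[½] → ℤ[½]) → ℤ[½] → Set
TrajectoryWithMast A f v = HasSlopesIn A f × HasMastValue f v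

trajectoryWithMast : ∀ {A f v} → 0ℤ ∈ A → (∀ {a} → a ∈ A → a ∈ Slopes) → Piecewise (Line A f)
    Everywhere →
                     ∀ τ → (∀ x → τ ≤ᴰ x → f x ≡ v) → TrajectoryWithMast A f v
trajectoryWithMast {A} {f} {v} 0∈A A⊆ p τ f≡v = (T , slopes∈) , (T , R.last-a , R.last-b)
  where
  ray = leftRay p τ (λ _ _ → tt)
  s = proj₁ ray
  open Line (proj₂ (proj₂ ray)) renaming (slope to a₀; slope∈ to a₀∈; intercept to b₀; equation to
      eq₀)
  module R = Rest (rest 0∈A (extend p (proj₁ (proj₂ ray)) (λ _ _ _ → tt) (mast f≡v)))
  slopes∈ : ∀ i → (a₀ Vec.∷ R.a) i ∈ A
  slopes∈ zero    = a₀∈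
  slopes∈ (suc i) = R.a∈ i
  T : DiadicTrajectory f
  T = record
    { n = R.n ; j = R.j ; a = a₀ Vec.∷ R.a ; b = b₀ Vec.∷ R.b
    ; a∈ = λ i → A⊆ (slopes∈ i)
    ; j-sorted = λ i → unwrap≤ (R.j-sorted i)
    ; first = λ x x≤j → eq₀ x (subst (x ≤ᴰ_) R.j-start (wrap≤ x≤j))
    ; middle = λ i x j≤x x≤j → R.middle i x (wrap≤ j≤x) (wrap≤ x≤j)
    ; last = λ x j≤x → R.last x (wrap≤ j≤x)
    ; joined = λ { zero → trans (sym (eq₀ (R.j zero) (≤-reflexive R.j-start))) (R.at-start zero)
                 ; (suc i) → trans (sym (R.middle i (R.j (suc i)) (R.j-sorted i) ≤-refl))
                     (R.at-start (suc i)) } }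

falling-trajectory : ∀ {f v} → Falling f → ∀ τ → (∀ x → τ ≤ᴰ x → f x ≡ v) →
                     TrajectoryWithMast (0ℤ ∷ -1ℤ ∷ []) f v
falling-trajectory {f} F = trajectoryWithMast (here refl)
  (λ { (here refl) → there (here refl) ; (there (here refl)) → here refl })
      (map to-line (Falling.pieces F))
  where
  to-line : ∀ {I} → Piece f I → Line (0ℤ ∷ -1ℤ ∷ []) f I
  to-line (constant b eq) = mkLine 0ℤ (here refl) b λ x Ix → trans (eq x Ix) (sym (line-0 b x))
  to-line (falling b eq)  = mkLine -1ℤ (there (here refl)) b λ x Ix →
    trans (sym (m+n-n≡m x (f x))) (trans (cong (_- x) (eq x Ix)) (sym (line--1 b x)))

rising-trajectory : ∀ {f v} → Falling (λ t → - f t) → ∀ τ → (∀ x → τ ≤ᴰ x → f x ≡ v) →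
                    TrajectoryWithMast (0ℤ ∷ 1ℤ ∷ []) f v
rising-trajectory {f} F = trajectoryWithMast (here refl)
  (λ { (here refl) → there (here refl) ; (there (here refl)) → there (there (here refl)) })
      (map to-line (Falling.pieces F))
  where
  to-line : ∀ {I} → Piece (λ t → - f t) I → Line (0ℤ ∷ 1ℤ ∷ []) f I
  to-line (constant b eq) = mkLine 0ℤ (here refl) (- b) λ x Ix →
    trans (trans (sym (neg-involutive (f x))) (cong (λ y → - y) (eq x Ix))) (sym (line-0 (- b) x))
  to-line (falling b eq)  = mkLine 1ℤ (there (here refl)) (- b) λ x Ix →
    trans (trans (trans (sym (m-n+n≡m x (f x))) (cong (_+ x)
        (trans (cong (λ y → y - x) (sym (neg-involutive (f x))))
        (trans (neg-distrib-+ (- f x) x) (cong (λ y → - y) (eq x Ix))))))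
      (+-comm (- b) x)) (sym (line-1 (- b) x))

-- Thermographs

-1ᴰ : ℤ[½]
-1ᴰ = integer -1ℤ

-- The induction hypothesis for one derivation. `ceiling` and `floor` speak of G itself and not of a
-- cooled game; a game with G as an option uses them to compare its λ̃ and ρ̃ at -1.
record Thermograph {G} (d : WellDefined G) : Set₁ where
  field
    λ-falling   : Falling (λₜ d)
    ρ-rising    : Falling (λ t → - ρₜ d t)
    mastBase    : ℤ[½]
    mastValue   : ℤ[½]
    λ-mast      : ∀ t → mastBase ≤ᴰ t → λₜ d t ≡ mastValue
    ρ-mast      : ∀ t → mastBase ≤ᴰ t → ρₜ d t ≡ mastValue
    leftStop    : ∀ t → IsLeftStop (cooled d t) (λₜ d t)
    rightStop   : ∀ t → IsRightStop (cooled d t) (ρₜ d t)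
    ceiling     : ∃[ c ] λₜ d -1ᴰ ≡ integer c × IsCeiling G c
    floor       : ∃[ r ] ρₜ d -1ᴰ ≡ integer r × IsFloor G r

  ρ-mono : ∀ {x y} → x ≤ᴰ y → ρₜ d x ≤ᴰ ρₜ d y
  ρ-mono {x} {y} x≤y = subst₂ _≤ᴰ_ (neg-involutive (ρₜ d x)) (neg-involutive (ρₜ d y))
      (neg-anti-≤ (Falling.antitone ρ-rising x≤y))

  mastValue≤λ : ∀ t → mastValue ≤ᴰ λₜ d t
  mastValue≤λ t with ≤-total mastBase t
  ... | inj₁ T≤t = ≤-reflexive (sym (λ-mast t T≤t))
  ... | inj₂ t≤T = subst (_≤ᴰ λₜ d t) (λ-mast mastBase ≤-refl) (Falling.antitone λ-falling t≤T)

  ρ≤mastValue : ∀ t → ρₜ d t ≤ᴰ mastValue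
  ρ≤mastValue t with ≤-total mastBase t
  ... | inj₁ T≤t = ≤-reflexive (ρ-mast t T≤t)
  ... | inj₂ t≤T = subst (ρₜ d t ≤ᴰ_) (ρ-mast mastBase ≤-refl) (ρ-mono t≤T)

  λ-trajectory : TrajectoryWithMast (0ℤ ∷ -1ℤ ∷ []) (λₜ d) mastValue
  λ-trajectory = falling-trajectory λ-falling mastBase λ-mast

  ρ-trajectory : TrajectoryWithMast (0ℤ ∷ 1ℤ ∷ []) (ρₜ d) mastValue
  ρ-trajectory = rising-trajectory ρ-rising mastBase ρ-mast

integer-+1 : ∀ n → integer n - -1ᴰ ≡ integer (ℤ.suc n)
integer-+1 n = trans (integer-+ n 1ℤ) (cong integer (ℤ.+-comm n 1ℤ))

integer--1 : ∀ n → integer n + -1ᴰ ≡ integer (ℤ.pred n)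
integer--1 n = trans (integer-+ n -1ℤ) (cong integer (ℤ.+-comm n -1ℤ))

≤⇒diff≤0 : ∀ x y → x ≤ᴰ y → x - y ≤ᴰ 0ᴰ
≤⇒diff≤0 x y x≤y = subst (x - y ≤ᴰ_) (+-inverseʳ y) (+-monoˡ-≤ (- y) x≤y)

<⇒0<diff : ∀ x y → y <ᴰ x → 0ᴰ <ᴰ x - y
<⇒0<diff x y y<x = subst (_<ᴰ x - y) (+-inverseʳ y) (+-monoˡ-< (- y) y<x)

module Options {m n} {GL : Vector Game (suc m)} {GR : Vector Game (suc n)}
               (dL : ∀ i → WellDefined (GL i)) (dR : ∀ j → WellDefined (GR j))
               (tL : ∀ i → Thermograph (dL i)) (tR : ∀ j → Thermograph (dR j)) where

  private
    G = ⟨ GL ∣ GR ⟩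
    module Left i = Thermograph (tL i)
    module Right j = Thermograph (tR j)

  λ̃-falling : Falling (λ̃ dL)
  λ̃-falling = falling-cong (λ t → max-cong (λ i → trans (sym (neg-distrib-+ (- ρₜ (dL i) t) t))
      (cong (_- t) (neg-involutive (ρₜ (dL i) t)))))
    (falling-max (λ i → falling-tax (Left.ρ-rising i)))

  ρ̃-rising : Falling (λ t → - ρ̃ dR t)
  ρ̃-rising = falling-cong (λ t → sym (neg-min (λ j → λₜ (dR j) t + t)))
      (falling-max (λ j → falling-tax (Right.λ-falling j)))

  ρ̃-mono : ∀ {x y} → x ≤ᴰ y → ρ̃ dR x ≤ᴰ ρ̃ dR y
  ρ̃-mono {x} {y} x≤y = subst₂ _≤ᴰ_ (neg-involutive (ρ̃ dR x)) (neg-involutive (ρ̃ dR y))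
      (neg-anti-≤ (Falling.antitone ρ̃-rising x≤y))

  r : Fin (suc m) → ℤ
  r i = proj₁ (Left.floor i)
  c : Fin (suc n) → ℤ
  c j = proj₁ (Right.ceiling j)

  floors : ∀ i → IsFloor (GL i) (r i)
  floors i = proj₂ (proj₂ (Left.floor i))
  ceilings : ∀ j → IsCeiling (GR j) (c j)
  ceilings j = proj₂ (proj₂ (Right.ceiling j))

  ρ-at--1 : ∀ i → ρₜ (dL i) -1ᴰ - -1ᴰ ≡ integer (ℤ.suc (r i))
  ρ-at--1 i = trans (cong (_- -1ᴰ) (proj₁ (proj₂ (Left.floor i)))) (integer-+1 (r i))

  λ-at--1 : ∀ j → λₜ (dR j) -1ᴰ + -1ᴰ ≡ integer (ℤ.pred (c j))
  λ-at--1 j = trans (cong (_+ -1ᴰ) (proj₁ (proj₂ (Right.ceiling j)))) (integer--1 (c j))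

  i₀ = proj₁ (max-sel (λ i → ρₜ (dL i) -1ᴰ - -1ᴰ))
  j₀ = proj₁ (min-sel (λ j → λₜ (dR j) -1ᴰ + -1ᴰ))
  c₀ = ℤ.suc (r i₀)
  r₀ = ℤ.pred (c j₀)

  λ̃-at--1 : λ̃ dL -1ᴰ ≡ integer c₀
  λ̃-at--1 = trans (proj₂ (max-sel (λ i → ρₜ (dL i) -1ᴰ - -1ᴰ))) (ρ-at--1 i₀)

  ρ̃-at--1 : ρ̃ dR -1ᴰ ≡ integer r₀
  ρ̃-at--1 = trans (proj₂ (min-sel (λ j → λₜ (dR j) -1ᴰ + -1ᴰ))) (λ-at--1 j₀)

  r<c₀ : ∀ i → ℤ.suc (r i) ℤ.≤ c₀
  r<c₀ i = integer-cancel-≤ _ _ (subst₂ _≤ᴰ_ (ρ-at--1 i) λ̃-at--1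
      (≤max (λ i → ρₜ (dL i) -1ᴰ - -1ᴰ) i))

  r₀<c : ∀ j → r₀ ℤ.≤ ℤ.pred (c j)
  r₀<c j = integer-cancel-≤ _ _ (subst₂ _≤ᴰ_ ρ̃-at--1 (λ-at--1 j)
      (min≤ (λ j → λₜ (dR j) -1ᴰ + -1ᴰ) j))

  integer⇒λ̃≤ρ̃ : EqualToInteger G → λ̃ dL -1ᴰ ≤ᴰ ρ̃ dR -1ᴰ
  integer⇒λ̃≤ρ̃ (k , G≈k) =
    let r<k , k<c = integer-between floors ceilings k (≈⇒≃ {G} {integerᴳ k} G≈k)
    in subst₂ _≤ᴰ_ (sym λ̃-at--1) (sym ρ̃-at--1) (integer-mono-≤ (ℤ.≤-trans (r<k i₀) (k<c j₀)))

  λ̃≤ρ̃⇒integer : λ̃ dL -1ᴰ ≤ᴰ ρ̃ dR -1ᴰ → EqualToInteger G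
  λ̃≤ρ̃⇒integer λ̃≤ρ̃ = fits-integer floors ceilings c₀ r<c₀
    (λ j → ℤ.≤-trans (integer-cancel-≤ c₀ r₀ (subst₂ _≤ᴰ_ λ̃-at--1 ρ̃-at--1 λ̃≤ρ̃)) (r₀<c j))

  -- V - t bounds λ̃ from above and W + t bounds ρ̃ from below. The bounds meet at h, so λ̃ ≤ ρ̃
  -- there, which gives the search for a meeting point its right end.
  V = max Left.mastValue
  W = min Right.mastValue
  h = half (V - W)

  W+h≡V-h : W + h ≡ V - h
  W+h≡V-h = trans (sym (m+n-n≡m h (W + h))) (cong (_- h)
    (trans (+-assoc W h h) (trans (cong (λ z → W + z) (half+half (V - W)))
        (trans (+-comm W (V - W)) (m-n+n≡m W V)))))

  λ̃≤ρ̃-at-h : λ̃ dL h ≤ᴰ ρ̃ dR h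
  λ̃≤ρ̃-at-h = ≤-trans
    (max-lub (λ i → ρₜ (dL i) h - h) (λ i → +-monoˡ-≤ (- h)
        (≤-trans (Left.ρ≤mastValue i h) (≤max Left.mastValue i))))
    (subst (_≤ᴰ ρ̃ dR h) W+h≡V-h
      (min-glb (λ j → λₜ (dR j) h + h) (λ j → +-monoˡ-≤ h
          (≤-trans (min≤ Right.mastValue j) (Right.mastValue≤λ j h)))))

  existsLeastMeeting : ¬ EqualToInteger G → ∃[ τ ] IsLeast (λ t → λ̃ dL t ≡ ρ̃ dR t) τ
  existsLeastMeeting G≉ =
    let τ , eq , least = leastMeeting λ̃-falling ρ̃-rising -1≤h
            (<⇒0<diff (λ̃ dL -1ᴰ) (ρ̃ dR -1ᴰ) ρ̃<λ̃) (≤⇒diff≤0 (λ̃ dL h) (ρ̃ dR h) λ̃≤ρ̃-at-h)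
    in τ , trans eq (neg-involutive (ρ̃ dR τ)) , λ y eq → least y
        (trans eq (sym (neg-involutive (ρ̃ dR y))))
    where
    ρ̃<λ̃ : ρ̃ dR -1ᴰ <ᴰ λ̃ dL -1ᴰ
    ρ̃<λ̃ = ≰⇒> (λ λ̃≤ρ̃ → G≉ (λ̃≤ρ̃⇒integer λ̃≤ρ̃))
    -1≤h : -1ᴰ ≤ᴰ h
    -- Were h below -1, monotonicity would carry λ̃ ≤ ρ̃ from h to -1.
    -1≤h = ≮⇒≥ λ h<-1 → <⇒≱ ρ̃<λ̃ (≤-trans (Falling.antitone λ̃-falling (<⇒≤ h<-1))
        (≤-trans λ̃≤ρ̃-at-h (ρ̃-mono (<⇒≤ h<-1))))

  module Meeting (G≉ : ¬ EqualToInteger G) τ (τ-least : IsLeast (λ t → λ̃ dL t ≡ ρ̃ dR t) τ) where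

    d : WellDefined G
    d = nonInteger G≉ dL dR τ τ-least

    meet : λ̃ dL τ ≡ ρ̃ dR τ
    meet = proj₁ τ-least

    -1<τ : -1ᴰ <ᴰ τ
    -1<τ = ≰⇒> λ τ≤-1 → G≉ (λ̃≤ρ̃⇒integer (≤-trans (Falling.antitone λ̃-falling τ≤-1)
        (≤-trans (≤-reflexive meet) (ρ̃-mono τ≤-1))))

    ρ̃≤λ̃ : ∀ {t} → t ≤ᴰ τ → ρ̃ dR t ≤ᴰ λ̃ dL t
    ρ̃≤λ̃ t≤τ = ≤-trans (ρ̃-mono t≤τ) (≤-trans (≤-reflexive (sym meet))
        (Falling.antitone λ̃-falling t≤τ))

    ρ̃<λ̃ : ∀ {t} → t <ᴰ τ → ρ̃ dR t <ᴰ λ̃ dL t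
    ρ̃<λ̃ {t} t<τ = ≰⇒> λ λ̃≤ρ̃ → <⇒≱ t<τ (wrap≤ (proj₂ τ-least t
        (≤-antisym λ̃≤ρ̃ (ρ̃≤λ̃ (<⇒≤ t<τ)))))

    λ-below : ∀ {t} → t ≤ᴰ τ → λₜ d t ≡ λ̃ dL t
    λ-below = truncate-below (λ̃ dL)
    λ-above : ∀ {t} → τ ≤ᴰ t → λₜ d t ≡ λ̃ dL τ
    λ-above = truncate-above (λ̃ dL)
    ρ-below : ∀ {t} → t ≤ᴰ τ → ρₜ d t ≡ ρ̃ dR t
    ρ-below = truncate-below (ρ̃ dR)
    ρ-above : ∀ {t} → τ ≤ᴰ t → ρₜ d t ≡ λ̃ dL τ
    ρ-above τ≤t = trans (truncate-above (ρ̃ dR) τ≤t) (sym meet)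

    neg-truncate : ∀ t → truncate (λ t → - ρ̃ dR t) τ t ≡ - ρₜ d t
    neg-truncate t = [
      (λ t≤τ → trans (truncate-below (λ t → - ρ̃ dR t) t≤τ)
          (cong (λ y → - y) (sym (ρ-below t≤τ)))) ,
      (λ τ≤t → trans (truncate-above (λ t → - ρ̃ dR t) τ≤t)
          (cong (λ y → - y) (trans (sym meet) (sym (ρ-above τ≤t))))) ]′
      (≤-total t τ)

    cooled-below : ∀ {t} → t ≤ᴰ τ →
      cooled d t ≡ ⟨ (λ i → cooled (dL i) t ⊝ numberᴳ t) ∣ (λ j → cooled (dR j) t ⊕ numberᴳ t) ⟩
    cooled-below {t} t≤τ = if-yes (t ≤? τ) (unwrap≤ t≤τ)

    -- Strict, unlike `λ-above`: at τ itself the cooled game is still formed from the options, and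
    -- it agrees with the mast value only up to an infinitesimal.
    cooled-above : ∀ {t} → τ <ᴰ t → cooled d t ≡ numberᴳ (λ̃ dL τ)
    cooled-above {t} τ<t = if-no (t ≤? τ) (λ t≤τ → <⇒≱ τ<t (wrap≤ t≤τ))

    module _ (t : ℤ[½]) where

      optionStopsL : ∀ i → IsRightStop (cooled (dL i) t ⊝ numberᴳ t) (ρₜ (dL i) t - t)
      optionStopsL i = rightStop-⊝ t (Left.rightStop i t)

      optionStopsR : ∀ j → IsLeftStop (cooled (dR j) t ⊕ numberᴳ t) (λₜ (dR j) t + t)
      optionStopsR j = leftStop-⊕ t (Right.leftStop j t)

      leftStop : IsLeftStop (cooled d t) (λₜ d t)
      leftStop = [ (λ t≤τ → subst₂ IsLeftStop (sym (cooled-below t≤τ)) (sym (λ-below t≤τ))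
                         (leftStop-options optionStopsL optionStopsR (ρ̃≤λ̃ t≤τ))) ,
        (λ τ<t → subst₂ IsLeftStop (sym (cooled-above τ<t)) (sym (λ-above (<⇒≤ τ<t)))
            (number-leftStop (λ̃ dL τ) ≃-refl)) ]′ (≤⊎> t τ)

      rightStop : IsRightStop (cooled d t) (ρₜ d t)
      rightStop = [ (λ t≤τ → subst₂ IsRightStop (sym (cooled-below t≤τ)) (sym (ρ-below t≤τ))
                         (rightStop-options optionStopsL optionStopsR (ρ̃≤λ̃ t≤τ))) ,
        (λ τ<t → subst₂ IsRightStop (sym (cooled-above τ<t)) (sym (ρ-above (<⇒≤ τ<t)))
            (number-rightStop (λ̃ dL τ) ≃-refl)) ]′ (≤⊎> t τ)

    thermograph-nonInteger : Thermograph d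
    thermograph-nonInteger = record
      { λ-falling = falling-truncate τ λ̃-falling
      ; ρ-rising = falling-cong neg-truncate (falling-truncate τ ρ̃-rising)
      ; mastBase = τ
      ; mastValue = λ̃ dL τ
      ; λ-mast = λ _ → λ-above
      ; ρ-mast = λ _ → ρ-above
      ; leftStop = leftStop
      ; rightStop = rightStop
      ; ceiling = c₀ , trans (λ-below (<⇒≤ -1<τ)) λ̃-at--1 , ceiling-options floors ceilings G≉
          r<c₀ (i₀ , refl)
      ; floor = r₀ , trans (ρ-below (<⇒≤ -1<τ)) ρ̃-at--1 , floor-options floors ceilings G≉ r₀<c
          (j₀ , refl) }

thermograph : ∀ {G} (d : WellDefined G) → Thermograph d
thermograph (isInteger {G} n G≈n) = record
  { λ-falling = falling-constant (integer n)
  ; ρ-rising = falling-constant (- integer n)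
  ; mastBase = 0ᴰ
  ; mastValue = integer n
  ; λ-mast = λ _ _ → refl
  ; ρ-mast = λ _ _ → refl
  ; leftStop = λ _ → number-leftStop (integer n) ≃-refl
  ; rightStop = λ _ → number-rightStop (integer n) ≃-refl
  ; ceiling = n , refl , integer-ceiling (≈⇒≃ {G} {integerᴳ n} G≈n)
  ; floor = n , refl , integer-floor (≈⇒≃ {G} {integerᴳ n} G≈n) }
thermograph (nonInteger G≉ dL dR τ τ-least) =
  Options.Meeting.thermograph-nonInteger dL dR (λ i → thermograph (dL i))
      (λ j → thermograph (dR j)) G≉ τ τ-least

-- Existence of derivations

integer⇒wellDefined : ∀ {G} → EqualToInteger G → WellDefined G
integer⇒wellDefined (n , G≈n) = isInteger n G≈n

-- A game without options on one side is an integer, since some integer lies beyond the floors or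
-- ceilings of all its options. So the maximum and minimum are taken over nonempty families, and
-- with options on both sides the comparison at -1 chooses the constructor.
options⇒wellDefined : ∀ {m n} {GL : Vector Game m} {GR : Vector Game n} →
                      (∀ i → WellDefined (GL i)) → (∀ j → WellDefined (GR j)) → WellDefined ⟨ GL ∣
                          GR ⟩
options⇒wellDefined {zero} dL dR =
  let ceilings = λ j → Thermograph.ceiling (thermograph (dR j))
      k , k<c = <min-integer (λ j → proj₁ (ceilings j))
  in integer⇒wellDefined (fits⇒integer k ((λ ()) , (λ j → IsCeiling.below
      (proj₂ (proj₂ (ceilings j))) (k<c j))))
options⇒wellDefined {suc m} {zero} dL dR =
  let floors = λ i → Thermograph.floor (thermograph (dL i))
      k , r<k = max<integer (λ i → proj₁ (floors i))
  in integer⇒wellDefined (fits⇒integer k ((λ i → IsFloor.above (proj₂ (proj₂ (floors i))) (r<k i))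
      , (λ ())))
options⇒wellDefined {suc m} {suc n} dL dR =
  [ (λ λ̃≤ρ̃ → integer⇒wellDefined (λ̃≤ρ̃⇒integer λ̃≤ρ̃)) ,
    (λ ρ̃<λ̃ → nonInteger⇒wellDefined (λ G≈ → <⇒≱ ρ̃<λ̃ (integer⇒λ̃≤ρ̃ G≈))) ]′
  (≤⊎> (λ̃ dL -1ᴰ) (ρ̃ dR -1ᴰ))
  where
  open Options dL dR (λ i → thermograph (dL i)) (λ j → thermograph (dR j))
  nonInteger⇒wellDefined : ¬ EqualToInteger _ → WellDefined _
  nonInteger⇒wellDefined G≉ = let τ , τ-least = existsLeastMeeting G≉ in nonInteger G≉ dL dR τ
                                      τ-least

wellDefined : ∀ G → WellDefined G
wellDefined ⟨ GL ∣ GR ⟩ = options⇒wellDefined (λ i → wellDefined (GL i)) (λ j → wellDefined (GR j))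

-- Numberish games and temperature

module _ {H : Game} {l r : ℤ[½]} (stopL : IsLeftStop H l) (stopR : IsRightStop H r) where

  -- If x < l, an ε below l - x is too small to bound H - x from above. Otherwise r < x, and a
  -- negative number above r - x is too large to bound H - x from below.
  distinctStops⇒¬numberish : r <ᴰ l → ¬ Numberish H
  distinctStops⇒¬numberish r<l (x , near) with ≤⊎> l x
  ... | inj₂ x<l =
    let ε , 0<ε , ε<l-x = <-dense (<⇒0<diff l x x<l)
        _ , H-x≤ε , _ = near ε (unwrap< 0<ε)
    in ≤ᴳ⇒¬⧏ (≽⇒≤ᴳ {numberᴳ ε} {H ⊝ numberᴳ x} H-x≤ε) (IsLeftStop.below (leftStop-⊝ x stopL) ε<l-x)
  ... | inj₁ l≤x =
    let y , r-x<y , y<0 = <-dense (subst (r - x <ᴰ_) (+-inverseʳ x)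
            (+-monoˡ-< (- x) (<-≤-trans r<l l≤x)))
        (-ε≤H-x , _) , _ = near (- y) (unwrap< (0<neg y y<0))
    in ≤ᴳ⇒¬⧏ (≤ᴳ-trans (proj₂ (⊖-neg y)) (≽⇒≤ᴳ {H ⊝ numberᴳ x} {⊖ numberᴳ (- y)} -ε≤H-x))
        (IsRightStop.above (rightStop-⊝ x stopR) r-x<y)
    where
    0<neg : ∀ y → y <ᴰ 0ᴰ → 0ᴰ <ᴰ - y
    0<neg y y<0 = subst (0ᴰ <ᴰ_) (+-identityˡ (- y)) (<⇒0<diff 0ᴰ y y<0)
    ⊖-neg : ∀ y → ⊖ numberᴳ (- y) ≃ numberᴳ y
    ⊖-neg y = ≃-trans (⊖-numberᴳ (- y)) (≃-reflexive (cong numberᴳ (neg-involutive y)))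

-- Both stops of H - x are 0. For each of the two bounds, one stop gives the weak inequality and the
-- other its strictness.
equalStops⇒numberish : ∀ {H x} → IsLeftStop H x → IsRightStop H x → Numberish H
equalStops⇒numberish {H} {x} stopL stopR = x , λ ε 0<ε → above-neg ε (wrap< 0<ε) , below-pos ε
    (wrap< 0<ε)
  where
  K = H ⊝ numberᴳ x
  stopL′ : IsLeftStop K 0ᴰ
  stopL′ = subst (IsLeftStop K) (+-inverseʳ x) (leftStop-⊝ x stopL)
  stopR′ : IsRightStop K 0ᴰ
  stopR′ = subst (IsRightStop K) (+-inverseʳ x) (rightStop-⊝ x stopR)
  neg<0 : ∀ ε → 0ᴰ <ᴰ ε → - ε <ᴰ 0ᴰ
  neg<0 ε 0<ε = subst₂ _<ᴰ_ (+-identityˡ (- ε)) (+-inverseʳ ε) (+-monoˡ-< (- ε) 0<ε)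
  above-neg : ∀ ε → 0ᴰ <ᴰ ε → (⊖ numberᴳ ε) ≺ K
  above-neg ε 0<ε = ≤ᴳ⇒≽ {K} {⊖ numberᴳ ε} (≤ᴳ-trans (proj₁ (⊖-numberᴳ ε))
      (IsRightStop.below stopR′ (neg<0 ε 0<ε))) ,
    λ -ε≽K → ≤ᴳ⇒¬⧏ (≤ᴳ-trans (≽⇒≤ᴳ {⊖ numberᴳ ε} {K} -ε≽K) (proj₁ (⊖-numberᴳ ε)))
        (IsLeftStop.below stopL′ (neg<0 ε 0<ε))
  below-pos : ∀ ε → 0ᴰ <ᴰ ε → K ≺ numberᴳ ε
  below-pos ε 0<ε = ≤ᴳ⇒≽ {numberᴳ ε} {K} (IsLeftStop.above stopL′ 0<ε) ,
    λ K≽ε → ≤ᴳ⇒¬⧏ (≽⇒≤ᴳ {K} {numberᴳ ε} K≽ε) (IsRightStop.above stopR′ 0<ε)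

module _ {G : Game} (G≉ : ¬ EqualToInteger G) where

  -1<temperature : (d : WellDefined G) → [ integer -1ℤ ] <₋ temperature d
  -1<temperature (isInteger n G≈n) = contradiction (n , G≈n) G≉
  -1<temperature (nonInteger G≉ dL dR τ τ-least) =
    [ unwrap< (Options.Meeting.-1<τ dL dR (λ i → thermograph (dL i)) (λ j → thermograph (dR j)) G≉
        τ τ-least) ]

  trichotomy : (d : WellDefined G) → ∀ t →
    ([ t ] <₋ temperature d → ¬ Numberish (cooled d t)) ×
    ([ t ] ≡ temperature d → Numberish (cooled d t)) ×
    (temperature d <₋ [ t ] → EqualToNumber (cooled d t))
  trichotomy (isInteger n G≈n) = contradiction (n , G≈n) G≉
  trichotomy (nonInteger G≉ dL dR τ τ-least) t = hot ∘ wrap< ∘ [<]-injective , tepid ∘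
      []-injective , cold ∘ wrap< ∘ [<]-injective
    where
    open Options.Meeting dL dR (λ i → thermograph (dL i)) (λ j → thermograph (dR j)) G≉ τ τ-least
    hot : t <ᴰ τ → ¬ Numberish (cooled d t)
    hot t<τ = distinctStops⇒¬numberish (leftStop t) (rightStop t)
      (subst₂ _<ᴰ_ (sym (ρ-below (<⇒≤ t<τ))) (sym (λ-below (<⇒≤ t<τ))) (ρ̃<λ̃ t<τ))
    tepid : t ≡ τ → Numberish (cooled d t)
    tepid refl = equalStops⇒numberish (leftStop t) (subst (IsRightStop (cooled d t))
        (trans (ρ-above ≤-refl) (sym (λ-above ≤-refl))) (rightStop t))
    cold : τ <ᴰ t → EqualToNumber (cooled d t)
    cold τ<t = λ̃ dL τ , ≃⇒≈ {cooled d t} {numberᴳ (λ̃ dL τ)} (≃-reflexive (cooled-above τ<t))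

theorem4 : (G : Game) →
    WellDefined G
    × ((d : WellDefined G) →
    (¬ EqualToInteger G → [ integer -1ℤ ] <₋ temperature d)
    × HasSlopesIn (0ℤ ∷ -1ℤ ∷ []) (λₜ d)
    × HasSlopesIn (0ℤ ∷ 1ℤ ∷ []) (ρₜ d)
    × (∃[ v ] HasMastValue (λₜ d) v × HasMastValue (ρₜ d) v)
    × (∀ t → LeftStop (cooled d t) (λₜ d t) × RightStop (cooled d t) (ρₜ d t))
    × (¬ EqualToInteger G → ∀ t → integer -1ℤ < t →
    ([ t ] <₋ temperature d → ¬ Numberish (cooled d t))
    × ([ t ] ≡ temperature d → Numberish (cooled d t))
    × (temperature d <₋ [ t ] → EqualToNumber (cooled d t))))
theorem4 G = wellDefined G , λ d → let T = thermograph d in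
  (λ G≉ → -1<temperature G≉ d) ,
  proj₁ (Thermograph.λ-trajectory T) ,
  proj₁ (Thermograph.ρ-trajectory T) ,
  (Thermograph.mastValue T , proj₂ (Thermograph.λ-trajectory T) , proj₂
      (Thermograph.ρ-trajectory T)) ,
  (λ t → isLeftStop⇒leftStop (Thermograph.leftStop T t) , isRightStop⇒rightStop
      (Thermograph.rightStop T t)) ,
  (λ G≉ t _ → trichotomy G≉ d t)
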